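{- Let $r_1,r_2\in\mathbb{Z}$ and let $(U_n)_{n\ge0}$ be a sequence of integers with $U_n=r_1U_{n-1}+r_2U_{n-2}$ for all $n\ge2$. Let $\alpha,\beta$ be the roots of $x^2-r_1x-r_2$, assume $\alpha\neq\beta$, let $\Delta=(\alpha-\beta)^2=r_1^2+4r_2$, and assume $\Delta$ is not the square of an integer. Let $l_1,l_2$ be the constants with $U_n=l_1\alpha^n+l_2\beta^n$ for all $n\ge0$. Then the following are equivalent: (1) $(U_n)_{n\ge1}$ almost satisfies the Dold condition; (2) $l_1=l_2$; (3) the sequence $(2r_2\operatorname{rad}(\Delta)U_n)_{n\ge1}$ satisfies the Dold condition.
   Context: A sequence of integers $(A_n)_{n\ge1}$ satisfies the Dold condition if $n\mid\sum_{d\mid n}\mu(d)A_{n/d}$ for every $n\in\mathbb{N}_+$ ($\mu$ the Möbius function). It almost satisfies the Dold condition if there is $c\in\mathbb{N}_+$ such that $(cA_n)_{n\ge1}$ satisfies the Dold condition. For a nonzero integer $m$, $\operatorname{rad}(m)$ denotes the product of the distinct primes dividing $m$. -}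

module Defs where

open import Data.Nat as ℕ using (ℕ; zero; suc)
open import Data.Nat.Divisibility using (_∣?_)
open import Data.Nat.Primality using (prime?)
open import Data.Integer as ℤ using (ℤ; +_; -[1+_]; ∣_∣)
open import Data.Integer.Divisibility using () renaming (_∣_ to _∣ℤ_)
open import Data.Rational as ℚ using (ℚ)
open import Data.Product using (_×_; _,_; Σ; proj₁; proj₂)
open import Relation.Nullary.Decidable using (does)
open import Data.Bool using (if_then_else_)

sum1to : ℕ → (ℕ → ℤ) → ℤ
sum1to zero    f = + 0
sum1to (suc n) f = sum1to n f ℤ.+ f (suc n)

prod2to : ℕ → (ℕ → ℤ) → ℤ
prod2to zero          g = + 1
prod2to (suc zero)    g = + 1
prod2to (suc (suc n)) g = prod2to (suc n) g ℤ.* g (suc (suc n))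

-- Möbius function: μ(n) = ∏_{p ≤ n prime} (0 if p² ∣ n, -1 if p ∣ n, 1 otherwise)
-- so μ(1) = 1, μ(n) = (-1)^k for squarefree n with k prime factors, 0 otherwise.
μ : ℕ → ℤ
μ n = prod2to n λ p →
  if does (prime? p)
  then (if does ((p ℕ.* p) ∣? n) then + 0
        else if does (p ∣? n) then ℤ.- (+ 1) else + 1)
  else + 1

-- rad(m): product of the distinct primes dividing m (for m ≠ 0).
rad : ℤ → ℤ
rad m = prod2to ∣ m ∣ λ p →
  if does (prime? p) then (if does (p ∣? ∣ m ∣) then + p else + 1) else + 1

doldSum : (ℕ → ℤ) → ℕ → ℤ
doldSum A n = sum1to n λ where
  zero    → + 0
  (suc k) → if does (suc k ∣? n) then μ (suc k) ℤ.* A (n ℕ./ suc k) else + 0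

-- (A_n)_{n≥1} satisfies the Dold condition (A 0 is never used).
Dold : (ℕ → ℤ) → Set
Dold A = (n : ℕ) → 1 ℕ.≤ n → (+ n) ∣ℤ doldSum A n

AlmostDold : (ℕ → ℤ) → Set
AlmostDold A = Σ ℕ λ c → (1 ℕ.≤ c) × Dold (λ n → + c ℤ.* A n)

-- The quadratic field ℚ(√D): a pair (a , b) represents a + b√D.
QF : Set
QF = ℚ × ℚ

ofℤ : ℤ → QF
ofℤ z = (z ℚ./ 1 , ℚ.0ℚ)

_⊕_ : QF → QF → QF
(a , b) ⊕ (c , d) = (a ℚ.+ c , b ℚ.+ d)

mulQ : ℤ → QF → QF → QF
mulQ D (a , b) (c , d) = (a ℚ.* c ℚ.+ (D ℚ./ 1) ℚ.* b ℚ.* d , a ℚ.* d ℚ.+ b ℚ.* c)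

powQ : ℤ → QF → ℕ → QF
powQ D x zero    = ofℤ (+ 1)
powQ D x (suc n) = mulQ D x (powQ D x n)

disc : ℤ → ℤ → ℤ
disc r₁ r₂ = r₁ ℤ.* r₁ ℤ.+ + 4 ℤ.* r₂

-- roots of x² - r₁x - r₂ in ℚ(√Δ): α = (r₁ + √Δ)/2, β = (r₁ - √Δ)/2
rootα : ℤ → QF
rootα r₁ = (r₁ ℚ./ 2 , ℚ.½)

rootβ : ℤ → QF
rootβ r₁ = (r₁ ℚ./ 2 , ℚ.-½)

{-# OPTIONS --safe #-}
module Submission where

-- Writing l₁ = l₂ in coordinates, it is equivalent to 2 U₁ = r₁ U₀, i.e. to 2 Uₙ = U₀ Vₙ with
-- Vₙ = αⁿ + βⁿ.  The sequence V satisfies the Gauss congruences V(pᵏ⁺¹ m) ≡ V(pᵏ m) mod pᵏ⁺¹: with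
-- (x , y) the trace and norm of α^(pᵏ m), raising to the p-th power is a polynomial map whose
-- derivative is divisible by p and which is the identity mod p.  Hence V is a Dold sequence.
--
-- Conversely, for an odd prime p one has 2 U_p ≡ r₁ U₀ + Δ^((p−1)/2) (2 U₁ − r₁ U₀) mod p.  If κ U is
-- Dold with κ ≠ 0, then p ∣ κ (U_p − U₁), so 2 U₁ ≠ r₁ U₀ would force Δ^((p−1)/2) ≡ 1 for all but finitely
-- many p.  By quadratic reciprocity p ↦ Δ^((p−1)/2) is given by a periodic multiplicative function
-- (proved with Gauss sums), which takes the value −1 at some n prime to the exceptional primes unless
-- Δ is a square; some prime factor of such an n is then a contradiction.

open import Defs
open import Data.Nat using (ℕ; suc)
open import Data.Integer using (ℤ; +_; _+_; _*_)
open import Data.Product using (_×_)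
open import Relation.Binary.PropositionalEquality using (_≡_; _≢_)
open import Function.Bundles using (_⇔_)

open import Data.Bool using (true; false; if_then_else_)
open import Data.Empty using (⊥; ⊥-elim)
open import Data.Integer using (-[1+_]; ∣_∣; _-_; -_; _^_)
open import Data.Integer.Divisibility.Signed using (_∣_; divides; ∣⇒∣ᵤ; ∣ᵤ⇒∣)
import Data.Integer.Properties as ℤₚ
open import Algebra.Properties.AbelianGroup ℤₚ.+-0-abelianGroup using () renaming (∙-cancelˡ to +-cancelˡ)
open import Data.Integer.Tactic.RingSolver using (solve-∀)
open import Data.List using ([]; _∷_)
open import Data.List.Relation.Unary.All using (All; []; _∷_)
open import Data.Nat as ℕ using (zero; NonZero; _!)
open import Data.Nat.Combinatorics using (_C_; nC1≡n; nCn≡1; nCk+nC[k+1]≡[n+1]C[k+1]; k>n⇒nCk≡0)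
open import Data.Nat.Coprimality using (Coprime; coprime-divisor; 1-coprimeTo) renaming (sym to coprime-sym)
import Data.Nat.Divisibility as ℕ∣
import Data.Nat.DivMod as ℕ/
open import Data.Nat.Induction using (<-rec)
open import Data.Nat.ListAction using (product)
open import Data.Nat.Primality
  using (Prime; prime?; prime[2]; ¬prime[0]; ¬prime[1]; euclidsLemma; prime⇒irreducible; prime⇒nonTrivial; prime⇒nonZero)
open import Data.Nat.Primality.Factorisation using (factorise; PrimeFactorisation)
import Data.Nat.Properties as ℕₚ
import Data.Nat.Tactic.RingSolver as ℕR
open import Data.Product using (_,_; ∃; ∃₂; proj₁; proj₂)
open import Data.Rational as ℚ using (ℚ; mkℚ; 0ℚ; 1ℚ; ½; -½; ↥_)
import Data.Rational.Properties as ℚₚ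
open import Data.Rational.Solver using (module +-*-Solver)
open import Data.Sum using (_⊎_; inj₁; inj₂; [_,_]′; map₂)
open import Function.Bundles using (mk⇔)
open import Relation.Binary.PropositionalEquality
  using (refl; sym; trans; cong; cong₂; subst; subst₂; module ≡-Reasoning)
open import Relation.Nullary using (¬_; Dec; yes; no; does; contradiction)
open import Relation.Nullary.Decidable using (dec-true; dec-false; does-⇔; toWitness; _×-dec_)

-- One device serves all congruences modulo a prime: (A + B)ᵖ ≡ Aᵖ + Bᵖ for commuting operators on
-- integer sequences, recorded only as Pascal's relation between the integers `S n i j`. It yields
-- Fermat's theorem (multiplication by a, and the identity), the value of U at a prime (r and 2T -
-- r, with T the shift), and the Gauss sums, where Σ χ(a) Tᵃ acts on periodic sequences and T takes
-- the place of a root of unity. Every congruence therefore stays between integers.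
--
-- The obstacle in the converse is that the Dold condition speaks about single primes, while
-- reciprocity describes a symbol by residue classes. The symbol is therefore carried as a
-- multiplicative function on all of ℕ, together with a bound on the primes in its period, and the
-- value -1 is produced at an explicit integer built by congruences.
--
-- The coefficient in (3) may be negative, so the obstruction is proved for all nonzero integer
-- multiples of U; it is nonzero because r₂ = 0 would make Δ a square. Its evenness matters in the
-- other direction, where U is (U₀ / 2) V.

infix 4 _≋_[_]

-- An equation rather than the divisibility of a difference: matching on `mod k refl` substitutes
-- `b + + m * k` for the left side, so that each closure property becomes one ring identity.
record _≋_[_] (a b : ℤ) (m : ℕ) : Set where
  constructor mod
  field
    quot  : ℤ
    equal : a ≡ b + + m * quot

≋-refl : ∀ {a m} → a ≋ a [ m ]
≋-refl {a} {m} = mod (+ 0) (lem a (+ m))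
  where
  lem : ∀ a m → a ≡ a + m * + 0
  lem = solve-∀

≡⇒≋ : ∀ {a b m} → a ≡ b → a ≋ b [ m ]
≡⇒≋ refl = ≋-refl

≋-sym : ∀ {a b m} → a ≋ b [ m ] → b ≋ a [ m ]
≋-sym {b = b} {m} (mod k refl) = mod (- k) (lem b (+ m) k)
  where
  lem : ∀ b m k → b ≡ b + m * k + m * - k
  lem = solve-∀

≋-trans : ∀ {a b c m} → a ≋ b [ m ] → b ≋ c [ m ] → a ≋ c [ m ]
≋-trans {c = c} {m} (mod k refl) (mod l refl) = mod (l + k) (lem c (+ m) k l)
  where
  lem : ∀ c m k l → c + m * l + m * k ≡ c + m * (l + k)
  lem = solve-∀

≋-+ : ∀ {a b c d m} → a ≋ b [ m ] → c ≋ d [ m ] → a + c ≋ b + d [ m ]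
≋-+ {b = b} {d = d} {m} (mod k refl) (mod l refl) = mod (k + l) (lem b d (+ m) k l)
  where
  lem : ∀ b d m k l → b + m * k + (d + m * l) ≡ b + d + m * (k + l)
  lem = solve-∀

≋-* : ∀ {a b c d m} → a ≋ b [ m ] → c ≋ d [ m ] → a * c ≋ b * d [ m ]
≋-* {b = b} {d = d} {m} (mod k refl) (mod l refl) =
  mod (b * l + k * d + k * (+ m * l)) (lem b d (+ m) k l)
  where
  lem : ∀ b d m k l → (b + m * k) * (d + m * l) ≡ b * d + m * (b * l + k * d + k * (m * l))
  lem = solve-∀

≋-neg : ∀ {a b m} → a ≋ b [ m ] → - a ≋ - b [ m ]
≋-neg {b = b} {m} (mod k refl) = mod (- k) (lem b (+ m) k)
  where
  lem : ∀ b m k → - (b + m * k) ≡ - b + m * - k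
  lem = solve-∀

≋-^ : ∀ {a b m} → a ≋ b [ m ] → ∀ n → a ^ n ≋ b ^ n [ m ]
≋-^ eq zero    = ≋-refl
≋-^ eq (suc n) = ≋-* eq (≋-^ eq n)

≋⇒∣ : ∀ {a b m} → a ≋ b [ m ] → + m ∣ a - b
≋⇒∣ {b = b} {m} (mod k refl) = divides k (lem b (+ m) k)
  where
  lem : ∀ b m k → b + m * k - b ≡ k * m
  lem = solve-∀

∣⇒≋ : ∀ {a b m} → + m ∣ a - b → a ≋ b [ m ]
∣⇒≋ {a} {b} {m} (divides k eq) = mod k (trans (lem a b) (cong (λ z → b + z) (trans eq (ℤₚ.*-comm k (+ m)))))
  where
  lem : ∀ a b → a ≡ b + (a - b)
  lem = solve-∀

∣⇒≋0 : ∀ {a m} → m ℕ∣.∣ a → + a ≋ + 0 [ m ]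
∣⇒≋0 {m = m} (ℕ∣.divides q refl) = mod (+ q) (trans (cong +_ (ℕₚ.*-comm q m))
    (trans (ℤₚ.pos-* m q) (sym (ℤₚ.+-identityˡ (+ m * + q)))))

≋0⇒∣ : ∀ {a m} → a ≋ + 0 [ m ] → m ℕ∣.∣ ∣ a ∣
≋0⇒∣ {m = m} (mod k refl) = ∣⇒∣ᵤ (divides k (trans (ℤₚ.+-identityˡ (+ m * k)) (ℤₚ.*-comm (+ m) k)))

≋-cancelˡ : ∀ {p} → Prime p → ∀ c {a b} → ¬ p ℕ∣.∣ ∣ c ∣ → c * a ≋ c * b [ p ] → a ≋ b [ p ]
≋-cancelˡ {p} pp c {a} {b} p∤c eq with euclidsLemma ∣ c ∣ ∣ a - b ∣ pp
    (subst (p ℕ∣.∣_) (trans (cong ∣_∣ (lem c a b)) (ℤₚ.abs-* c (a - b))) (∣⇒∣ᵤ (≋⇒∣ eq)))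
  where
  lem : ∀ c a b → c * a - c * b ≡ c * (a - b)
  lem = solve-∀
... | inj₁ p∣c = contradiction p∣c p∤c
... | inj₂ p∣a-b = ∣⇒≋ (∣ᵤ⇒∣ p∣a-b)

-- Sums over an initial segment

Σ< : ℕ → (ℕ → ℤ) → ℤ
Σ< zero    f = + 0
Σ< (suc n) f = Σ< n f + f n

Σ<-cong : ∀ n {f g} → (∀ a → a ℕ.< n → f a ≡ g a) → Σ< n f ≡ Σ< n g
Σ<-cong zero    eq = refl
Σ<-cong (suc n) eq = cong₂ _+_ (Σ<-cong n λ a a<n → eq a (ℕₚ.m<n⇒m<1+n a<n)) (eq n (ℕₚ.n<1+n n))

Σ<-cong-≋ : ∀ n {f g m} → (∀ a → a ℕ.< n → f a ≋ g a [ m ]) → Σ< n f ≋ Σ< n g [ m ]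
Σ<-cong-≋ zero    eq = ≋-refl
Σ<-cong-≋ (suc n) eq = ≋-+ (Σ<-cong-≋ n λ a a<n → eq a (ℕₚ.m<n⇒m<1+n a<n)) (eq n (ℕₚ.n<1+n n))

Σ<-zero : ∀ n {f} → (∀ a → a ℕ.< n → f a ≡ + 0) → Σ< n f ≡ + 0
Σ<-zero zero    eq = refl
Σ<-zero (suc n) eq = cong₂ _+_ (Σ<-zero n λ a a<n → eq a (ℕₚ.m<n⇒m<1+n a<n)) (eq n (ℕₚ.n<1+n n))

Σ<-+ : ∀ n f g → Σ< n (λ a → f a + g a) ≡ Σ< n f + Σ< n g
Σ<-+ zero    f g = refl
Σ<-+ (suc n) f g = trans (cong (_+ (f n + g n)) (Σ<-+ n f g)) (lem (Σ< n f) (Σ< n g) (f n) (g n))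
  where
  lem : ∀ a b c d → a + b + (c + d) ≡ a + c + (b + d)
  lem = solve-∀

Σ<-*ˡ : ∀ n c f → Σ< n (λ a → c * f a) ≡ c * Σ< n f
Σ<-*ˡ zero    c f = sym (ℤₚ.*-zeroʳ c)
Σ<-*ˡ (suc n) c f = trans (cong (_+ c * f n) (Σ<-*ˡ n c f)) (sym (ℤₚ.*-distribˡ-+ c _ _))

Σ<-suc : ∀ n f → Σ< (suc n) f ≡ f 0 + Σ< n (λ a → f (suc a))
Σ<-suc zero    f = ℤₚ.+-comm (+ 0) (f 0)
Σ<-suc (suc n) f = trans (cong (_+ f (suc n)) (Σ<-suc n f)) (ℤₚ.+-assoc (f 0) _ _)

Σ<-swap : ∀ m n (f : ℕ → ℕ → ℤ) → Σ< m (λ a → Σ< n (f a)) ≡ Σ< n (λ b → Σ< m (λ a → f a b))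
Σ<-swap zero    n f = sym (Σ<-zero n λ _ _ → refl)
Σ<-swap (suc m) n f = trans (cong (_+ Σ< n (f m)) (Σ<-swap m n f)) (sym (Σ<-+ n _ (f m)))

-- The Frobenius congruence

-- The absorption identity is kept free of division, so that for `suc n` prime Euclid's lemma
-- applies to it directly.
C-absorb : ∀ n k → suc k ℕ.* (suc n C suc k) ≡ suc n ℕ.* (n C k)
C-absorb n zero = trans (cong (1 ℕ.*_) (nC1≡n (suc n))) (ℕₚ.*-comm 1 (suc n))
C-absorb zero (suc k) = ℕₚ.*-zeroʳ (suc (suc k))
C-absorb (suc n) (suc k) = begin
  suc (suc k) ℕ.* (suc (suc n) C suc (suc k))
    ≡⟨ cong (suc (suc k) ℕ.*_) (sym (nCk+nC[k+1]≡[n+1]C[k+1] (suc n) (suc k))) ⟩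
  suc (suc k) ℕ.* (X ℕ.+ (suc n C suc (suc k)))
    ≡⟨ lem₁ (suc k) X (suc n C suc (suc k)) ⟩
  X ℕ.+ (suc k ℕ.* X ℕ.+ suc (suc k) ℕ.* (suc n C suc (suc k)))
    ≡⟨ cong (X ℕ.+_) (cong₂ ℕ._+_ (C-absorb n k) (C-absorb n (suc k))) ⟩
  X ℕ.+ (suc n ℕ.* (n C k) ℕ.+ suc n ℕ.* (n C suc k))
    ≡⟨ cong (X ℕ.+_) (sym (ℕₚ.*-distribˡ-+ (suc n) (n C k) (n C suc k))) ⟩
  X ℕ.+ suc n ℕ.* (n C k ℕ.+ n C suc k)
    ≡⟨ cong (λ z → X ℕ.+ suc n ℕ.* z) (nCk+nC[k+1]≡[n+1]C[k+1] n k) ⟩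
  suc (suc n) ℕ.* X ∎
  where
  open ≡-Reasoning
  X = suc n C suc k
  lem₁ : ∀ k x y → suc k ℕ.* (x ℕ.+ y) ≡ x ℕ.+ (k ℕ.* x ℕ.+ suc k ℕ.* y)
  lem₁ = ℕR.solve-∀

p∣pCk : ∀ {p} → Prime p → ∀ k → suc k ℕ.< p → p ℕ∣.∣ p C suc k
p∣pCk {suc n} pp k k<p with euclidsLemma (suc k) (suc n C suc k) pp
    (ℕ∣.divides (n C k) (trans (C-absorb n k) (ℕₚ.*-comm (suc n) (n C k))))
... | inj₁ p∣k = contradiction (ℕ∣.∣⇒≤ p∣k) (ℕₚ.<⇒≱ k<p)
... | inj₂ p∣C = p∣C

Pascal : (ℕ → ℕ → ℕ → ℤ) → Set
Pascal S = ∀ n i j → S (suc n) i j ≡ S n (suc i) j + S n i (suc j)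

-- The binomial theorem for (A + B)ⁿ Aⁱ Bʲ. The exponents i and j are arbitrary because each step of
-- the induction on n moves a factor A or B into them.
Pascal-expand : ∀ S → Pascal S → ∀ n i j →
  S n i j ≡ Σ< (suc n) (λ k → + (n C k) * S 0 (i ℕ.+ k) (j ℕ.+ (n ℕ.∸ k)))
Pascal-expand S pas zero i j = trans (lem (S 0 i j)) (cong₂ (λ a b → + 0 + + 1 * S 0 a b)
    (sym (ℕₚ.+-identityʳ i)) (sym (ℕₚ.+-identityʳ j)))
  where
  lem : ∀ x → x ≡ + 0 + + 1 * x
  lem = solve-∀
Pascal-expand S pas (suc n) i j = begin
  S (suc n) i j
    ≡⟨ pas n i j ⟩
  S n (suc i) j + S n i (suc j)
    ≡⟨ cong₂ _+_ (Pascal-expand S pas n (suc i) j) (Pascal-expand S pas n i (suc j)) ⟩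
  Σ< (suc n) u + Σ< (suc n) v
    ≡⟨ cong₂ _+_ (Σ<-cong (suc n) λ k _ → cong (λ z → + (n C k) * S 0 z (j ℕ.+ (n ℕ.∸ k))) (sym (ℕₚ.+-suc i k)))
                 (trans (sym (ℤₚ.+-identityʳ _)) (cong (λ z → Σ< (suc n) v + z) v-last)) ⟩
  Σ< (suc n) (λ k → + (n C k) * t (suc k)) + Σ< (suc (suc n)) v
    ≡⟨ cong (λ z → Σ< (suc n) (λ k → + (n C k) * t (suc k)) + z)
         (trans (Σ<-suc (suc n) v) (cong (λ z → v 0 + z) (Σ<-cong (suc n) v-shift))) ⟩
  Σ< (suc n) (λ k → + (n C k) * t (suc k)) + (v 0 + Σ< (suc n) (λ k → + (n C suc k) * t (suc k)))
    ≡⟨ lem (Σ< (suc n) (λ k → + (n C k) * t (suc k))) (v 0) (Σ< (suc n) (λ k → + (n C suc k) * t (suc k))) ⟩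
  v 0 + (Σ< (suc n) (λ k → + (n C k) * t (suc k)) + Σ< (suc n) (λ k → + (n C suc k) * t (suc k)))
    ≡⟨ cong₂ _+_ v-zero (sym (Σ<-+ (suc n) _ _)) ⟩
  + (suc n C 0) * t 0 + Σ< (suc n) (λ k → + (n C k) * t (suc k) + + (n C suc k) * t (suc k))
    ≡⟨ cong (λ z → + (suc n C 0) * t 0 + z) (Σ<-cong (suc n) λ k _ →
         trans (sym (ℤₚ.*-distribʳ-+ (t (suc k)) (+ (n C k)) (+ (n C suc k))))
               (cong (λ z → + z * t (suc k)) (nCk+nC[k+1]≡[n+1]C[k+1] n k))) ⟩
  + (suc n C 0) * t 0 + Σ< (suc n) (λ k → + (suc n C suc k) * t (suc k))
    ≡⟨ sym (Σ<-suc (suc n) (λ k → + (suc n C k) * t k)) ⟩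
  Σ< (suc (suc n)) (λ k → + (suc n C k) * t k) ∎
  where
  open ≡-Reasoning
  t u v : ℕ → ℤ
  t k = S 0 (i ℕ.+ k) (j ℕ.+ (suc n ℕ.∸ k))
  u k = + (n C k) * S 0 (suc i ℕ.+ k) (j ℕ.+ (n ℕ.∸ k))
  v k = + (n C k) * S 0 (i ℕ.+ k) (suc j ℕ.+ (n ℕ.∸ k))
  lem : ∀ a b c → a + (b + c) ≡ b + (a + c)
  lem = solve-∀
  -- The vanishing term k = n + 1 is appended to the second sum; once `v 0` is split off, both sums
  -- run over the same terms `t (suc k)`.
  v-last : + 0 ≡ v (suc n)
  v-last = sym (cong (λ z → + z * S 0 (i ℕ.+ suc n) (suc j ℕ.+ (n ℕ.∸ suc n))) (k>n⇒nCk≡0 (ℕₚ.n<1+n n)))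
  v-shift : ∀ k → k ℕ.< suc n → v (suc k) ≡ + (n C suc k) * t (suc k)
  v-shift k (ℕ.s≤s k≤n) with ℕₚ.m≤n⇒m<n∨m≡n k≤n
  ... | inj₁ k<n = cong (λ z → + (n C suc k) * S 0 (i ℕ.+ suc k) z)
        (trans (sym (ℕₚ.+-suc j (n ℕ.∸ suc k))) (cong (j ℕ.+_) (sym (ℕₚ.+-∸-assoc 1 k<n))))
  -- At k = n the truncated subtractions give different indices, but the binomial coefficient is 0
  -- on both sides.
  ... | inj₂ refl rewrite k>n⇒nCk≡0 (ℕₚ.n<1+n k) = refl
  v-zero : v 0 ≡ + (suc n C 0) * t 0
  v-zero = cong (λ b → + 1 * S 0 (i ℕ.+ 0) b) (sym (ℕₚ.+-suc j n))

-- For S n i j = (A + B)ⁿ Aⁱ Bʲ x with commuting A, B this says (A + B)ᵖ ≡ Aᵖ + Bᵖ.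
frobenius : ∀ {p} → Prime p → ∀ {S} → Pascal S → S p 0 0 ≋ S 0 p 0 + S 0 0 p [ p ]
frobenius {suc n} pp {S} pas =
  ≋-trans (≡⇒≋ (trans (Pascal-expand S pas p 0 0) (cong (_+ t p) (Σ<-suc n t))))
  (≋-trans (≋-+ (≋-+ (≋-refl {t 0}) (Σ<-cong-≋ n {g = λ _ → + 0} mid)) (≋-refl {t p}))
  (≡⇒≋ (trans (cong₂ (λ a b → + 1 * S 0 0 p + a + b) (Σ<-zero n λ _ _ → refl)
                (cong₂ (λ a b → + a * S 0 p b) (nCn≡1 p) (ℕₚ.n∸n≡0 n)))
              (lem (S 0 0 p) (S 0 p 0)))))
  where
  p = suc n
  t : ℕ → ℤ
  t k = + (p C k) * S 0 k (p ℕ.∸ k)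
  mid : ∀ k → k ℕ.< n → t (suc k) ≋ + 0 [ p ]
  mid k k<n = ≋-* (∣⇒≋0 (p∣pCk pp k (ℕ.s≤s k<n))) (≋-refl {S 0 (suc k) (p ℕ.∸ suc k)})
  lem : ∀ a b → + 1 * a + + 0 + + 1 * b ≡ b + a
  lem = solve-∀

-- Frobenius with A = a and B = 1 gives (a + 1)ᵖ ≡ aᵖ + 1. The induction starts at 0 and runs in
-- both directions, since a may be negative.
fermat : ∀ {p} → Prime p → ∀ a → a ^ p ≋ a [ p ]
fermat {p} pp = go
  where
  add-one : ∀ a → (a + + 1) ^ p ≋ a ^ p + + 1 [ p ]
  add-one a = ≋-trans (≡⇒≋ (sym (ℤₚ.*-identityʳ _)))
    (≋-trans (frobenius pp {S = λ n i j → (a + + 1) ^ n * a ^ i} λ n i j → lem a ((a + + 1) ^ n) (a ^ i))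
             (≡⇒≋ (cong (λ z → z + + 1) (ℤₚ.*-identityˡ (a ^ p)))))
    where
    lem : ∀ a x y → (a + + 1) * x * y ≡ x * (a * y) + x * y
    lem = solve-∀
  up : ∀ a → a ^ p ≋ a [ p ] → (a + + 1) ^ p ≋ a + + 1 [ p ]
  up a eq = ≋-trans (add-one a) (≋-+ eq ≋-refl)
  down : ∀ a → (a + + 1) ^ p ≋ a + + 1 [ p ] → a ^ p ≋ a [ p ]
  down a eq = ≋-trans (≡⇒≋ (lem (a ^ p)))
    (≋-trans (≋-+ (≋-trans (≋-sym (add-one a)) eq) (≋-refl { - + 1})) (≡⇒≋ (sym (lem a))))
    where
    lem : ∀ x → x ≡ x + + 1 + - + 1
    lem = solve-∀
  zero^ : ∀ {p} → Prime p → (+ 0) ^ p ≋ + 0 [ p ]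
  zero^ {suc p} _ = ≋-refl
  go : ∀ a → a ^ p ≋ a [ p ]
  go (+ zero)      = zero^ pp
  go (+ suc n)     = subst (λ z → z ^ p ≋ z [ p ]) (cong +_ (ℕₚ.+-comm n 1)) (up (+ n) (go (+ n)))
  go -[1+ zero ]   = down -[1+ 0 ] (zero^ pp)
  go -[1+ suc n ]  = down -[1+ suc n ] (go -[1+ n ])

-- Second order recurrences

Recurrence : ℤ → ℤ → (ℕ → ℤ) → Set
Recurrence r s U = ∀ n → U (suc (suc n)) ≡ r * U (suc n) + s * U n

-- The shift T satisfies (2T − r)² = Δ on solutions, and Frobenius expands (2T)ᵖ = (r + (2T − r))ᵖ.
recurrence-at-prime : ∀ r s U → Recurrence r s U → ∀ h → Prime (suc (h ℕ.+ h)) →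
  + 2 * U (suc (h ℕ.+ h)) ≋ r * U 0 + (r * r + + 4 * s) ^ h * (+ 2 * U 1 - r * U 0) [ suc (h ℕ.+ h) ]
recurrence-at-prime r s U rec h pp =
  ≋-trans (≋-* (≋-sym (fermat pp (+ 2))) (≋-refl {U p}))
  (≋-trans (≡⇒≋ (sym (lem₀ ((+ 2) ^ p) (U p))))
  (≋-trans (frobenius pp {S} pascal)
  (≋-trans (≡⇒≋ (lem₁ (r ^ p) (U 0) (σ p 0)))
  (≋-+ (≋-* (fermat pp r) (≋-refl {U 0})) (≡⇒≋ (σ-odd h))))))
  where
  p = suc (h ℕ.+ h)
  Δ = r * r + + 4 * s
  -- `σ j n` is (2T - r)ʲ U at n. It is defined through the rule (2T - r)² = Δ, and `σ-suc` recovers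
  -- the linear rule from the recurrence.
  σ : ℕ → ℕ → ℤ
  σ zero n          = U n
  σ (suc zero) n    = + 2 * U (suc n) - r * U n
  σ (suc (suc j)) n = Δ * σ j n
  σ-suc : ∀ j n → σ (suc j) n ≡ + 2 * σ j (suc n) - r * σ j n
  σ-suc zero n = refl
  σ-suc (suc zero) n = sym (trans
    (cong (λ z → + 2 * (+ 2 * z - r * U (suc n)) - r * (+ 2 * U (suc n) - r * U n)) (rec n))
    (lem r s (U (suc n)) (U n)))
    where
    lem : ∀ r s a b → + 2 * (+ 2 * (r * a + s * b) - r * a) - r * (+ 2 * a - r * b) ≡ (r * r + + 4 * s) * b
    lem = solve-∀
  σ-suc (suc (suc j)) n = trans (cong (Δ *_) (σ-suc j n)) (lem Δ (σ j (suc n)) r (σ j n))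
    where
    lem : ∀ d a r b → d * (+ 2 * a - r * b) ≡ + 2 * (d * a) - r * (d * b)
    lem = solve-∀
  σ-odd : ∀ h → σ (suc (h ℕ.+ h)) 0 ≡ Δ ^ h * (+ 2 * U 1 - r * U 0)
  σ-odd zero    = sym (ℤₚ.*-identityˡ _)
  σ-odd (suc h) rewrite ℕₚ.+-suc h h = trans (cong (Δ *_) (σ-odd h)) (sym (ℤₚ.*-assoc Δ (Δ ^ h) _))
  -- Here A = r and B = 2T - r, so that (A + B)ⁿ = 2ⁿTⁿ contributes the factor 2ⁿ and moves σ to the
  -- index n.
  S : ℕ → ℕ → ℕ → ℤ
  S n i j = (+ 2) ^ n * r ^ i * σ j n
  pascal : Pascal S
  pascal n i j = sym (trans (cong (λ z → (+ 2) ^ n * (r * r ^ i) * σ j n + (+ 2) ^ n * r ^ i * z) (σ-suc j n))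
                            (lem ((+ 2) ^ n) (r ^ i) r (σ j n) (σ j (suc n))))
    where
    lem : ∀ t x r a b → t * (r * x) * a + t * x * (+ 2 * b - r * a) ≡ + 2 * t * x * b
    lem = solve-∀
  lem₀ : ∀ a b → a * + 1 * b ≡ a * b
  lem₀ = solve-∀
  lem₁ : ∀ a b c → + 1 * a * b + + 1 * + 1 * c ≡ a * b + c
  lem₁ = solve-∀

-- With roots α, β of z² − xz + y : trace n = αⁿ + βⁿ and lucas n = (αⁿ − βⁿ) / (α − β).
trace lucas : ℤ → ℤ → ℕ → ℤ
trace x y zero          = + 2
trace x y (suc zero)    = x
trace x y (suc (suc n)) = x * trace x y (suc n) + - y * trace x y n
lucas x y zero          = + 0
lucas x y (suc zero)    = + 1
lucas x y (suc (suc n)) = x * lucas x y (suc n) + - y * lucas x y n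

trace-recurrence : ∀ x y → Recurrence x (- y) (trace x y)
trace-recurrence x y n = refl

-- αⁿ and βⁿ are the roots of z² - (trace n) z + yⁿ, so a solution sampled at steps of n obeys the
-- recurrence with that trace and norm.
recurrence-double : ∀ {x y W} → Recurrence x (- y) W → ∀ n m →
  W (m ℕ.+ n ℕ.+ n) ≡ trace x y n * W (m ℕ.+ n) - y ^ n * W m
recurrence-double {x} {y} {W} rec zero m rewrite ℕₚ.+-identityʳ m | ℕₚ.+-identityʳ m = lem (W m)
  where
  lem : ∀ w → w ≡ + 2 * w - + 1 * w
  lem = solve-∀
recurrence-double {x} {y} {W} rec (suc zero) m rewrite ℕₚ.+-comm m 1 | ℕₚ.+-comm m 1 =
  trans (rec m) (lem x y (W (suc m)) (W m))
  where
  lem : ∀ x y a b → x * a + - y * b ≡ x * a - y * + 1 * b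
  lem = solve-∀
recurrence-double {x} {y} {W} rec (suc (suc n)) m = begin
  W (m ℕ.+ suc (suc n) ℕ.+ suc (suc n))
    ≡⟨ cong W (idx₁ m n) ⟩
  W (suc (suc a))
    ≡⟨ rec a ⟩
  x * W (suc a) + - y * W a
    ≡⟨ cong₂ (λ u v → x * u + - y * v)
         (trans (cong W (idx₂ m n)) (trans (recurrence-double rec (suc n) (suc m))
             (cong (λ z → t₁ * W z - y ^ suc n * W (suc m)) (idx₃ m n))))
         (trans (cong W (idx₄ m n)) (trans (recurrence-double rec n (suc (suc m)))
             (cong (λ z → t₀ * W z - y ^ n * W (suc (suc m))) (idx₅ m n)))) ⟩
  x * (t₁ * w - y * y ^ n * W (suc m)) + - y * (t₀ * w - y ^ n * W (suc (suc m)))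
    ≡⟨ cong (λ z → x * (t₁ * w - y * y ^ n * W (suc m)) + - y * (t₀ * w - y ^ n * z)) (rec m) ⟩
  x * (t₁ * w - y * y ^ n * W (suc m)) + - y * (t₀ * w - y ^ n * (x * W (suc m) + - y * W m))
    ≡⟨ lem x y t₁ t₀ w (y ^ n) (W (suc m)) (W m) ⟩
  trace x y (suc (suc n)) * w - y ^ suc (suc n) * W m ∎
  where
  open ≡-Reasoning
  a = suc (suc (m ℕ.+ n ℕ.+ n))
  w = W (m ℕ.+ suc (suc n))
  t₁ = trace x y (suc n)
  t₀ = trace x y n
  idx₁ : ∀ m n → m ℕ.+ suc (suc n) ℕ.+ suc (suc n) ≡ suc (suc (suc (suc (m ℕ.+ n ℕ.+ n))))
  idx₁ = ℕR.solve-∀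
  idx₂ : ∀ m n → suc (suc (suc (m ℕ.+ n ℕ.+ n))) ≡ suc m ℕ.+ suc n ℕ.+ suc n
  idx₂ = ℕR.solve-∀
  idx₃ : ∀ m n → suc m ℕ.+ suc n ≡ m ℕ.+ suc (suc n)
  idx₃ = ℕR.solve-∀
  idx₄ : ∀ m n → suc (suc (m ℕ.+ n ℕ.+ n)) ≡ suc (suc m) ℕ.+ n ℕ.+ n
  idx₄ = ℕR.solve-∀
  idx₅ : ∀ m n → suc (suc m) ℕ.+ n ≡ m ℕ.+ suc (suc n)
  idx₅ = ℕR.solve-∀
  lem : ∀ x y t₁ t₀ w yn b c →
    x * (t₁ * w - y * yn * b) + - y * (t₀ * w - yn * (x * b + - y * c)) ≡
    (x * t₁ + - y * t₀) * w - y * (y * yn) * c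
  lem = solve-∀

-- αᵐⁿ = (αⁿ)ᵐ: replacing α by αⁿ turns the pair (x , y) into (trace n , yⁿ).
trace-* : ∀ x y m n → trace x y (m ℕ.* n) ≡ trace (trace x y n) (y ^ n) m
trace-* x y zero n = refl
trace-* x y (suc zero) n = cong (trace x y) (ℕₚ.*-identityˡ n)
trace-* x y (suc (suc m)) n = begin
  trace x y (n ℕ.+ (n ℕ.+ m ℕ.* n))
    ≡⟨ cong (trace x y) (idx (m ℕ.* n) n) ⟩
  trace x y (m ℕ.* n ℕ.+ n ℕ.+ n)
    ≡⟨ recurrence-double (trace-recurrence x y) n (m ℕ.* n) ⟩
  t * trace x y (m ℕ.* n ℕ.+ n) - y ^ n * trace x y (m ℕ.* n)
    ≡⟨ cong₂ (λ a b → t * a - y ^ n * b)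
         (trans (cong (trace x y) (ℕₚ.+-comm (m ℕ.* n) n)) (trace-* x y (suc m) n)) (trace-* x y m n) ⟩
  t * trace t (y ^ n) (suc m) - y ^ n * trace t (y ^ n) m
    ≡⟨ cong (λ z → t * trace t (y ^ n) (suc m) + z) (ℤₚ.neg-distribˡ-* (y ^ n) (trace t (y ^ n) m)) ⟩
  trace t (y ^ n) (suc (suc m)) ∎
  where
  open ≡-Reasoning
  t = trace x y n
  idx : ∀ a n → n ℕ.+ (n ℕ.+ a) ≡ a ℕ.+ n ℕ.+ n
  idx = ℕR.solve-∀

-- Writing traces through Lucas numbers turns the induction step of `trace-taylor` into a polynomial
-- identity in two consecutive Lucas numbers.
trace-lucas : ∀ x y n → trace x y (suc n) ≡ lucas x y (suc (suc n)) - y * lucas x y n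
trace-lucas x y zero = lem x y
  where
  lem : ∀ x y → x ≡ x * + 1 + - y * + 0 - y * + 0
  lem = solve-∀
trace-lucas x y (suc zero) = lem x y
  where
  lem : ∀ x y → x * x + - y * + 2 ≡ x * (x * + 1 + - y * + 0) + - y * + 1 - y * + 1
  lem = solve-∀
trace-lucas x y (suc (suc n)) =
  trans (cong₂ (λ a b → x * a + - y * b) (trace-lucas x y (suc n)) (trace-lucas x y n))
        (lem x y (lucas x y (suc n)) (lucas x y n))
  where
  lem : ∀ x y b c → let d = x * b + - y * c; e = x * d + - y * b; f = x * e + - y * d in
    x * (e - y * b) + - y * (d - y * c) ≡ f - y * d
  lem = solve-∀

-- The derivative of trace n is n · (lucas n , − lucas (n − 1)).
trace-taylor : ∀ x y d s t n → ∃ λ z →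
  trace (x + d * s) (y + d * t) (suc n) ≡
  trace x y (suc n) + + suc n * (d * (s * lucas x y (suc n) - t * lucas x y n)) + d * d * z
trace-taylor x y d s t zero = + 0 , lem x d s t
  where
  lem : ∀ x d s t → x + d * s ≡ x + + 1 * (d * (s * + 1 - t * + 0)) + d * d * + 0
  lem = solve-∀
trace-taylor x y d s t (suc zero) = s * s , lem x y d s t
  where
  lem : ∀ x y d s t → (x + d * s) * (x + d * s) + - (y + d * t) * + 2 ≡
    x * x + - y * + 2 + + 2 * (d * (s * (x * + 1 + - y * + 0) - t * + 1)) + d * d * (s * s)
  lem = solve-∀
trace-taylor x y d s t (suc (suc n)) with trace-taylor x y d s t (suc n) | trace-taylor x y d s t n
... | z₁ , eq₁ | z₀ , eq₀ = z , (begin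
  (x + d * s) * trace (x + d * s) (y + d * t) (suc (suc n)) + - (y + d * t) * trace (x + d * s) (y + d * t)
      (suc n)
    ≡⟨ cong₂ (λ a b → (x + d * s) * a + - (y + d * t) * b) eq₁ eq₀ ⟩
  (x + d * s) * (trace x y (suc (suc n)) + + suc (suc n) * (d * (s * f₂ - t * f₁)) + d * d * z₁)
    + - (y + d * t) * (trace x y (suc n) + + suc n * (d * (s * f₁ - t * f₀)) + d * d * z₀)
    ≡⟨ cong₂ (λ a b → (x + d * s) * (a + + suc (suc n) * (d * (s * f₂ - t * f₁)) + d * d * z₁)
         + - (y + d * t) * (b + + suc n * (d * (s * f₁ - t * f₀)) + d * d * z₀)) (trace-lucas x y (suc n))
             (trace-lucas x y n) ⟩
  (x + d * s) * (x * f₂ + - y * f₁ - y * f₁ + (+ 1 + + suc n) * (d * (s * f₂ - t * f₁)) + d * d * z₁)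
    + - (y + d * t) * (f₂ - y * f₀ + + suc n * (d * (s * f₁ - t * f₀)) + d * d * z₀)
    ≡⟨ lem x y d s t (+ suc n) f₁ f₀ z₁ z₀ ⟩
  x * (x * f₂ + - y * f₁ - y * f₁) + - y * (f₂ - y * f₀) + (+ 1 + (+ 1 + + suc n)) *
      (d * (s * (x * f₂ + - y * f₁) - t * f₂)) + d * d * z
    ≡⟨ cong₂ (λ a b → x * a + - y * b + + suc (suc (suc n)) *
        (d * (s * (x * f₂ + - y * f₁) - t * f₂)) + d * d * z)
        (sym (trace-lucas x y (suc n))) (sym (trace-lucas x y n)) ⟩
  trace x y (suc (suc (suc n))) + + suc (suc (suc n)) *
      (d * (s * lucas x y (suc (suc (suc n))) - t * f₂)) + d * d * z ∎)
  where
  open ≡-Reasoning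
  f₂ = lucas x y (suc (suc n))
  f₁ = lucas x y (suc n)
  f₀ = lucas x y n
  k = + suc n
  -- The second-order part: the increments s and t of the coefficients meet the two earlier
  -- derivatives, and the remainders z₁ and z₀ are carried along by the new coefficients.
  z = s * ((+ 1 + k) * (s * f₂ - t * f₁)) - t * (k * (s * f₁ - t * f₀)) + (x + d * s) * z₁ - (y + d * t) * z₀
  lem : ∀ x y d s t k f₁ f₀ z₁ z₀ → let f₂ = x * f₁ + - y * f₀ in
    (x + d * s) * (x * f₂ + - y * f₁ - y * f₁ + (+ 1 + k) * (d * (s * f₂ - t * f₁)) + d * d * z₁)
    + - (y + d * t) * (f₂ - y * f₀ + k * (d * (s * f₁ - t * f₀)) + d * d * z₀) ≡
    x * (x * f₂ + - y * f₁ - y * f₁) + - y * (f₂ - y * f₀) + (+ 1 + (+ 1 + k)) *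
        (d * (s * (x * f₂ + - y * f₁) - t * f₂))
    + d * d * (s * ((+ 1 + k) * (s * f₂ - t * f₁)) - t * (k * (s * f₁ - t * f₀)) + (x + d * s) * z₁ -
        (y + d * t) * z₀)
  lem = solve-∀

-- Parity of primes and the Gauss congruences for traces

even⊎odd : ∀ n → (∃ λ h → n ≡ h ℕ.+ h) ⊎ (∃ λ h → n ≡ suc (h ℕ.+ h))
even⊎odd zero = inj₁ (0 , refl)
even⊎odd (suc n) with even⊎odd n
... | inj₁ (h , refl) = inj₂ (h , refl)
... | inj₂ (h , refl) = inj₁ (suc h , cong suc (sym (ℕₚ.+-suc h h)))

prime∣prime⇒≡ : ∀ {p q} → Prime p → Prime q → p ℕ∣.∣ q → p ≡ q
prime∣prime⇒≡ pp pq p∣q with prime⇒irreducible pq p∣q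
... | inj₁ refl = contradiction pp ¬prime[1]
... | inj₂ eq   = eq

2∣h+h : ∀ h → 2 ℕ∣.∣ h ℕ.+ h
2∣h+h h = ℕ∣.divides h (trans (cong (h ℕ.+_) (sym (ℕₚ.+-identityʳ h))) (ℕₚ.*-comm 2 h))

prime-odd : ∀ {p} → Prime p → p ≢ 2 → ∃ λ h → p ≡ suc (h ℕ.+ h)
prime-odd {p} pp p≢2 with even⊎odd p
... | inj₂ odd        = odd
... | inj₁ (h , refl) = contradiction (sym (prime∣prime⇒≡ prime[2] pp (2∣h+h h))) p≢2

-- For odd p the Δ-term of `recurrence-at-prime` carries the factor 2V₁ - xV₀ = 0, which leaves 2V_p
-- ≡ 2x. For p = 2 one has V₂ = x² - 2y.
trace-prime : ∀ {p} → Prime p → ∀ x y → trace x y p ≋ x [ p ]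
trace-prime {p} pp x y with p ℕ.≟ 2
... | yes refl = ≋-trans (mod (- y) (lem x y)) (fermat pp x)
  where
  lem : ∀ x y → x * x + - y * + 2 ≡ x * (x * + 1) + + 2 * - y
  lem = solve-∀
... | no p≢2 with prime-odd pp p≢2
... | h , refl = ≋-cancelˡ pp (+ 2) (λ p∣2 → p≢2 (prime∣prime⇒≡ pp prime[2] p∣2))
      (≋-trans (recurrence-at-prime x (- y) (trace x y) (trace-recurrence x y) h pp)
               (≡⇒≋ (lem x ((x * x + + 4 * - y) ^ h))))
  where
  lem : ∀ x D → x * + 2 + D * (+ 2 * x - x * + 2) ≡ + 2 * x
  lem = solve-∀

-- The first-order term of `trace-taylor` is a multiple of (n + 1) d, and so is d² because n + 1
-- divides d; this is why d has the form `suc n * e`.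
trace-lift : ∀ n e {x x′ y y′} → let d = suc n ℕ.* e in
  x′ ≋ x [ d ] → y′ ≋ y [ d ] → trace x′ y′ (suc n) ≋ trace x y (suc n) [ suc n ℕ.* d ]
trace-lift n e {x} {y = y} (mod s refl) (mod t refl) with trace-taylor x y (+ (suc n ℕ.* e)) s t n
... | z , eq = mod (X + + e * z) (trans eq
      (trans (cong (λ d → T + P * (d * X) + d * d * z) (ℤₚ.pos-* (suc n) e))
      (trans (lem T P (+ e) X z) (cong (λ d → T + d * (X + + e * z)) (sym de)))))
  where
  P = + suc n
  T = trace x y (suc n)
  X = s * lucas x y (suc n) - t * lucas x y n
  de : + (suc n ℕ.* (suc n ℕ.* e)) ≡ P * (P * + e)
  de = trans (ℤₚ.pos-* (suc n) _) (cong (P *_) (ℤₚ.pos-* (suc n) e))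
  lem : ∀ T P e X z → T + P * (P * e * X) + P * e * (P * e) * z ≡ T + P * (P * e) * (X + e * z)
  lem = solve-∀

-- At norm 0 the roots are x and 0, so that powers are traces and inherit `trace-lift`. The exponent
-- is positive because the trace at exponent 0 is 2.
trace-^ : ∀ x n → trace x (+ 0) (suc n) ≡ x ^ suc n
trace-^ x zero = sym (ℤₚ.*-identityʳ x)
trace-^ x (suc n) = trans (cong (λ z → x * z + + 0 * trace x (+ 0) n) (trace-^ x n))
    (lem (x * x ^ suc n) (trace x (+ 0) n))
  where
  lem : ∀ a b → a + + 0 * b ≡ a
  lem = solve-∀

^-lift : ∀ n e {y y′} → let d = suc n ℕ.* e in
  y′ ≋ y [ d ] → y′ ^ suc n ≋ y ^ suc n [ suc n ℕ.* d ]
^-lift n e {y} {y′} eq = subst₂ (λ a b → a ≋ b [ suc n ℕ.* (suc n ℕ.* e) ]) (trace-^ y′ n) (trace-^ y n)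
  (trace-lift n e eq (≋-refl {+ 0}))

GaussCongruences : (ℕ → ℤ) → Set
GaussCongruences A = ∀ {p} → Prime p → ∀ k m → A (p ℕ.^ suc k ℕ.* m) ≋ A (p ℕ.^ k ℕ.* m) [ p ℕ.^ suc k ]

trace-gauss : ∀ x y → GaussCongruences (trace x y)
trace-gauss x y {suc n} pp k m = proj₁ (go k)
  where
  p = suc n
  X Y : ℕ → ℤ
  X k = trace x y (p ℕ.^ k ℕ.* m)
  Y k = y ^ (p ℕ.^ k ℕ.* m)
  X-suc : ∀ k → X (suc k) ≡ trace (X k) (Y k) p
  X-suc k = trans (cong (trace x y) (ℕₚ.*-assoc p (p ℕ.^ k) m)) (trace-* x y p (p ℕ.^ k ℕ.* m))
  Y-suc : ∀ k → Y (suc k) ≡ Y k ^ p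
  Y-suc k = trans (cong (y ^_) (trans (ℕₚ.*-assoc p (p ℕ.^ k) m) (ℕₚ.*-comm p (p ℕ.^ k ℕ.* m))))
                  (sym (ℤₚ.^-*-assoc y (p ℕ.^ k ℕ.* m) p))
  -- Trace and norm are lifted together: the congruence for the next trace depends on both arguments
  -- being congruent modulo pᵏ⁺¹.
  go : ∀ k → (X (suc k) ≋ X k [ p ℕ.^ suc k ]) × (Y (suc k) ≋ Y k [ p ℕ.^ suc k ])
  go zero = subst (λ d → (X 1 ≋ X 0 [ d ]) × (Y 1 ≋ Y 0 [ d ])) (sym (ℕₚ.*-identityʳ p))
    (≋-trans (≡⇒≋ (X-suc 0)) (trace-prime pp (X 0) (Y 0)) , ≋-trans (≡⇒≋ (Y-suc 0)) (fermat pp (Y 0)))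
  go (suc k) with go k
  ... | eqX , eqY =
      ≋-trans (≡⇒≋ (X-suc (suc k))) (≋-trans (trace-lift n (p ℕ.^ k) eqX eqY) (≡⇒≋ (sym (X-suc k))))
    , ≋-trans (≡⇒≋ (Y-suc (suc k))) (≋-trans (^-lift n (p ℕ.^ k) eqY) (≡⇒≋ (sym (Y-suc k))))

-- The Möbius function

prod2to-cong : ∀ n {f g} → (∀ i → i ℕ.≤ n → f i ≡ g i) → prod2to n f ≡ prod2to n g
prod2to-cong zero          eq = refl
prod2to-cong (suc zero)    eq = refl
prod2to-cong (suc (suc n)) eq =
  cong₂ _*_ (prod2to-cong (suc n) λ i i≤ → eq i (ℕₚ.m≤n⇒m≤1+n i≤)) (eq (suc (suc n)) ℕₚ.≤-refl)

prod2to-extend : ∀ n k {f} → (∀ i → n ℕ.< i → f i ≡ + 1) → prod2to (k ℕ.+ n) f ≡ prod2to n f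
prod2to-extend n             zero    eq = refl
prod2to-extend zero          (suc zero)    eq = refl
prod2to-extend zero          (suc (suc k)) {f} eq =
  cong₂ _*_ (prod2to-extend zero (suc k) eq) (eq _ (ℕ.s≤s ℕ.z≤n))
prod2to-extend (suc n)       (suc k) {f} eq = subst (λ z → prod2to z f ≡ prod2to (suc n) f)
    (cong suc (sym (ℕₚ.+-suc k n)))
  (trans (cong₂ _*_ (trans (cong (λ z → prod2to z f) (sym (ℕₚ.+-suc k n))) (prod2to-extend (suc n) k eq))
                    (eq _ (ℕ.s≤s (ℕ.s≤s (ℕₚ.m≤n+m n k)))))
  (ℤₚ.*-identityʳ _))

prod2to-zero : ∀ n {f} i → 2 ℕ.≤ i → i ℕ.≤ n → f i ≡ + 0 → prod2to n f ≡ + 0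
prod2to-zero zero i 2≤i i≤n eq = contradiction (ℕₚ.≤-trans 2≤i i≤n) λ ()
prod2to-zero (suc zero) i 2≤i i≤n eq = contradiction (ℕₚ.≤-trans 2≤i i≤n) λ { (ℕ.s≤s ()) }
prod2to-zero (suc (suc n)) {f} i 2≤i i≤n eq =
  [ earlier (λ i≤ → prod2to-zero (suc n) i 2≤i i≤ eq) , last ]′ (ℕₚ.m≤n⇒m<n∨m≡n i≤n)
  where
  earlier : (i ℕ.≤ suc n → prod2to (suc n) f ≡ + 0) →
    i ℕ.< suc (suc n) → prod2to (suc n) f * f (suc (suc n)) ≡ + 0
  earlier ih (ℕ.s≤s i≤) = trans (cong (_* f (suc (suc n))) (ih i≤)) (ℤₚ.*-zeroˡ (f (suc (suc n))))
  last : i ≡ suc (suc n) → prod2to (suc n) f * f (suc (suc n)) ≡ + 0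
  last refl = trans (cong (prod2to (suc n) f *_) eq) (ℤₚ.*-zeroʳ (prod2to (suc n) f))

prod2to-change : ∀ n {f g} c i → 2 ℕ.≤ i → i ℕ.≤ n → f i ≡ c * g i → (∀ j → j ≢ i → f j ≡ g j) →
  prod2to n f ≡ c * prod2to n g
prod2to-change zero c i 2≤i i≤n _ _ = contradiction (ℕₚ.≤-trans 2≤i i≤n) λ ()
prod2to-change (suc zero) c i 2≤i i≤n _ _ = contradiction (ℕₚ.≤-trans 2≤i i≤n) λ { (ℕ.s≤s ()) }
prod2to-change (suc (suc n)) {f} {g} c i 2≤i i≤n eq eqs =
  [ earlier (λ i≤ → prod2to-change (suc n) c i 2≤i i≤ eq eqs) , last ]′ (ℕₚ.m≤n⇒m<n∨m≡n i≤n)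
  where
  earlier : (i ℕ.≤ suc n → prod2to (suc n) f ≡ c * prod2to (suc n) g) →
    i ℕ.< suc (suc n) → prod2to (suc n) f * f (suc (suc n)) ≡ c * (prod2to (suc n) g * g (suc (suc n)))
  earlier ih i<@(ℕ.s≤s i≤) =
    trans (cong₂ _*_ (ih i≤) (eqs _ λ e → ℕₚ.<⇒≢ i< (sym e)))
          (ℤₚ.*-assoc c _ _)
  last : i ≡ suc (suc n) → prod2to (suc n) f * f (suc (suc n)) ≡ c * (prod2to (suc n) g * g (suc (suc n)))
  last refl =
    trans (cong₂ _*_ (prod2to-cong (suc n) λ j j≤ → eqs j λ e → ℕₚ.<⇒≢ (ℕ.s≤s j≤) e) eq)
          (lem c (prod2to (suc n) g) (g (suc (suc n))))
    where
    lem : ∀ c a b → a * (c * b) ≡ c * (a * b)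
    lem = solve-∀

μ-factor : ℕ → ℕ → ℤ
μ-factor n p =
  if does (prime? p)
  then (if does ((p ℕ.* p) ℕ∣.∣? n) then + 0
        else if does (p ℕ∣.∣? n) then - (+ 1) else + 1)
  else + 1

if-yes : ∀ {a} {P : Set} {A : Set a} (P? : Dec P) {x y : A} → P → (if does P? then x else y) ≡ x
if-yes P? p rewrite dec-true P? p = refl

if-no : ∀ {a} {P : Set} {A : Set a} (P? : Dec P) {x y : A} → ¬ P → (if does P? then x else y) ≡ y
if-no P? ¬p rewrite dec-false P? ¬p = refl

μ-factor-1 : ∀ n p → ¬ p ℕ∣.∣ n → μ-factor n p ≡ + 1
μ-factor-1 n p p∤n with prime? p
... | no _  = refl
... | yes _ = trans (if-no (p ℕ.* p ℕ∣.∣? n) λ pp∣n → p∤n (ℕ∣.∣-trans (ℕ∣.m∣m*n p) pp∣n))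
    (if-no (p ℕ∣.∣? n) p∤n)

prime-2≤ : ∀ {p} → Prime p → 2 ℕ.≤ p
prime-2≤ {p} pp = ℕ.nonTrivial⇒n>1 p
  where instance _ = prime⇒nonTrivial pp

μ-square : ∀ {p} → Prime p → ∀ n .{{_ : NonZero n}} → p ℕ.* p ℕ∣.∣ n → μ n ≡ + 0
μ-square {p} pp n pp∣n = prod2to-zero n {μ-factor n} p (prime-2≤ pp) (ℕ∣.∣⇒≤ (ℕ∣.∣-trans (ℕ∣.m∣m*n p) pp∣n))
  (trans (if-yes (prime? p) pp) (if-yes (p ℕ.* p ℕ∣.∣? n) pp∣n))

prime-power-∣ : ∀ {p q} → Prime p → Prime q → p ≢ q → ∀ k e → p ℕ.^ k ℕ∣.∣ q ℕ.* e → p ℕ.^ k ℕ∣.∣ e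
prime-power-∣ pp pq p≢q zero    e _ = ℕ∣.1∣ e
prime-power-∣ {p} {q} pp pq p≢q (suc k) e (ℕ∣.divides c eq)
  with euclidsLemma q e pp (ℕ∣.divides (c ℕ.* p ℕ.^ k) (trans eq
      (trans (cong (c ℕ.*_) (ℕₚ.*-comm p (p ℕ.^ k))) (sym (ℕₚ.*-assoc c _ p)))))
... | inj₁ p∣q = contradiction (prime∣prime⇒≡ pp pq p∣q) p≢q
... | inj₂ (ℕ∣.divides e′ refl) = subst (p ℕ.* p ℕ.^ k ℕ∣.∣_) (ℕₚ.*-comm p e′) (ℕ∣.*-monoʳ-∣ p
      (prime-power-∣ pp pq p≢q k e′ (ℕ∣.divides c (ℕₚ.*-cancelʳ-≡ _ _ p (trans (ℕₚ.*-assoc q e′ p) (trans eq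
        (trans (cong (c ℕ.*_) (ℕₚ.*-comm p (p ℕ.^ k))) (sym (ℕₚ.*-assoc c _ p)))))))))
  where instance _ = prime⇒nonZero pp

μ-factor-other : ∀ {p} → Prime p → ∀ e q → q ≢ p → μ-factor (p ℕ.* e) q ≡ μ-factor e q
μ-factor-other {p} pp e q q≢p with prime? q
... | no _ = refl
... | yes pq = cong₂ (λ a b → if a then + 0 else (if b then - (+ 1) else + 1))
      (does-⇔ (mk⇔ (λ d → subst (λ z → q ℕ.* z ℕ∣.∣ e) (ℕₚ.*-identityʳ q) (prime-power-∣ pq pp q≢p 2 e
                  (subst (λ z → q ℕ.* z ℕ∣.∣ p ℕ.* e) (sym (ℕₚ.*-identityʳ q)) d)))
                   (ℕ∣.∣n⇒∣m*n p))
              (q ℕ.* q ℕ∣.∣? p ℕ.* e) (q ℕ.* q ℕ∣.∣? e))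
      (does-⇔ (mk⇔ (λ d → subst (ℕ∣._∣ e) (ℕₚ.*-identityʳ q) (prime-power-∣ pq pp q≢p 1 e
                  (subst (ℕ∣._∣ p ℕ.* e) (sym (ℕₚ.*-identityʳ q)) d)))
                   (ℕ∣.∣n⇒∣m*n p))
              (q ℕ∣.∣? p ℕ.* e) (q ℕ∣.∣? e))

-- Passing from e to p e changes only the factor at p, from 1 to -1. The product also becomes
-- longer, since its range is the argument of μ, but the factors beyond e are 1.
μ-prime-* : ∀ {p} → Prime p → ∀ e .{{_ : NonZero e}} → ¬ p ℕ∣.∣ e → μ (p ℕ.* e) ≡ - μ e
μ-prime-* {p} pp e p∤e = begin
  μ (p ℕ.* e)
    ≡⟨ prod2to-change (p ℕ.* e) {μ-factor (p ℕ.* e)} {μ-factor e} (- + 1) p (prime-2≤ pp) (ℕₚ.m≤m*n p e)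
         at-p (μ-factor-other pp e) ⟩
  - + 1 * prod2to (p ℕ.* e) (μ-factor e)
    ≡⟨ cong (- + 1 *_) (trans (cong (λ z → prod2to z (μ-factor e)) (sym (ℕₚ.m∸n+n≡m (ℕₚ.m≤n*m e p))))
         (prod2to-extend e (p ℕ.* e ℕ.∸ e) λ i e<i → μ-factor-1 e i (ℕ∣.>⇒∤ e<i))) ⟩
  - + 1 * μ e
    ≡⟨ ℤₚ.-1*i≡-i (μ e) ⟩
  - μ e ∎
  where
  open ≡-Reasoning
  instance _ = prime⇒nonZero pp
  at-p : μ-factor (p ℕ.* e) p ≡ - + 1 * μ-factor e p
  at-p = trans (if-yes (prime? p) pp) (trans (if-no (p ℕ.* p ℕ∣.∣? p ℕ.* e) λ d → p∤e (ℕ∣.*-cancelˡ-∣ p d))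
    (trans (if-yes (p ℕ∣.∣? p ℕ.* e) (ℕ∣.m∣m*n e)) (cong (- + 1 *_) (sym (μ-factor-1 e p p∤e)))))

-- Prime divisors and splitting off prime powers

prime-divisor : ∀ n → 2 ℕ.≤ n → ∃ λ p → Prime p × p ℕ∣.∣ n
prime-divisor (suc n) 2≤n = go (PrimeFactorisation.factors F) (PrimeFactorisation.isFactorisation F)
    (PrimeFactorisation.factorsPrime F)
  where
  F = factorise (suc n)
  go : ∀ ps → suc n ≡ product ps → All Prime ps → ∃ λ p → Prime p × p ℕ∣.∣ suc n
  go [] refl _ = contradiction 2≤n λ { (ℕ.s≤s ()) }
  go (p ∷ ps) eq (pp ∷ _) = p , pp , subst (p ℕ∣.∣_) (sym eq) (ℕ∣.m∣m*n (product ps))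

coprime-prime : ∀ {p e} → Prime p → ¬ p ℕ∣.∣ e → Coprime e p
coprime-prime pp p∤e (d∣e , d∣p) with prime⇒irreducible pp d∣p
... | inj₁ d≡1  = d≡1
... | inj₂ refl = contradiction d∣e p∤e

∣p^k*m⇒∣m : ∀ {p e} → Prime p → ¬ p ℕ∣.∣ e → ∀ k m → e ℕ∣.∣ p ℕ.^ k ℕ.* m → e ℕ∣.∣ m
∣p^k*m⇒∣m pp p∤e zero    m e∣ = subst (_ ℕ∣.∣_) (ℕₚ.*-identityˡ m) e∣
∣p^k*m⇒∣m {p} {e} pp p∤e (suc k) m e∣ =
  ∣p^k*m⇒∣m pp p∤e k m (coprime-divisor (coprime-prime pp p∤e) (subst (e ℕ∣.∣_) (ℕₚ.*-assoc p (p ℕ.^ k) m) e∣))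

PrimeSplit : ℕ → ℕ → Set
PrimeSplit p n = ∃₂ λ k m → n ≡ p ℕ.^ k ℕ.* m × ¬ p ℕ∣.∣ m

prime-split : ∀ {p} → Prime p → ∀ n .{{_ : NonZero n}} → PrimeSplit p n
prime-split {p} pp n@(suc _) = <-rec (λ n → NonZero n → PrimeSplit p n) step n _
  where
  instance _ = prime⇒nonZero pp
  step : ∀ n → (∀ {m} → m ℕ.< n → NonZero m → PrimeSplit p m) → NonZero n → PrimeSplit p n
  step n rec n≢0 with p ℕ∣.∣? n
  ... | no p∤n = 0 , n , sym (ℕₚ.*-identityˡ n) , p∤n
  ... | yes (ℕ∣.divides zero refl) = contradiction refl (ℕ.≢-nonZero⁻¹ 0 {{n≢0}})
  ... | yes (ℕ∣.divides q@(suc _) refl) with rec (ℕₚ.m<m*n q p (prime-2≤ pp)) _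
  ... | k , m , eq , p∤m = suc k , m , trans (ℕₚ.*-comm q p)
      (trans (cong (p ℕ.*_) eq) (sym (ℕₚ.*-assoc p (p ℕ.^ k) m))) , p∤m

-- Reduces a divisibility by n to one prime at a time. The full power of p is split off from n; the
-- remaining part m is coprime to it and divides s by induction, so it divides the cofactor of that
-- power in s.
prime-powers⇒∣ : ∀ n .{{_ : NonZero n}} s → (∀ {p} → Prime p → ∀ k → p ℕ.^ k ℕ∣.∣ n → p ℕ.^ k ℕ∣.∣ s) → n ℕ∣.∣ s
prime-powers⇒∣ n@(suc _) s = <-rec (λ n → NonZero n → Locally n → n ℕ∣.∣ s) step n _
  where
  Locally : ℕ → Set
  Locally n = ∀ {p} → Prime p → ∀ k → p ℕ.^ k ℕ∣.∣ n → p ℕ.^ k ℕ∣.∣ s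
  step : ∀ n → (∀ {m} → m ℕ.< n → NonZero m → Locally m → m ℕ∣.∣ s) → NonZero n → Locally n → n ℕ∣.∣ s
  step 1 rec _ loc = ℕ∣.1∣ s
  step n@(suc (suc _)) rec _ loc with prime-divisor n (ℕ.s≤s (ℕ.s≤s ℕ.z≤n))
  ... | p , pp , p∣n with prime-split pp n
  ... | zero  , m , eq , p∤m = contradiction (subst (p ℕ∣.∣_) (trans eq (ℕₚ.*-identityˡ m)) p∣n) p∤m
  ... | suc k , zero , eq , p∤m = contradiction (p ℕ∣.∣0) p∤m
  ... | suc k , m@(suc _) , eq , p∤m with loc pp (suc k) (subst (p ℕ.^ suc k ℕ∣.∣_) (sym eq) (ℕ∣.m∣m*n m))
  ... | ℕ∣.divides t refl = subst₂ ℕ∣._∣_ (sym eq) (ℕₚ.*-comm (p ℕ.^ suc k) t) (ℕ∣.*-monoʳ-∣ (p ℕ.^ suc k)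
        (∣p^k*m⇒∣m pp p∤m (suc k) t (subst (m ℕ∣.∣_) (ℕₚ.*-comm t _)
          (rec m<n _ λ pp′ k′ d → loc pp′ k′ (ℕ∣.∣-trans d
              (subst (m ℕ∣.∣_) (sym eq) (ℕ∣.n∣m*n (p ℕ.^ suc k))))))))
    where
    instance
      _ = prime⇒nonZero pp
      _ = ℕₚ.m^n≢0 p k
    m<n : m ℕ.< n
    m<n = subst (m ℕ.<_) (trans (ℕₚ.*-comm m _) (sym eq))
        (ℕₚ.m<m*n m (p ℕ.^ suc k) (ℕₚ.≤-trans (prime-2≤ pp) (ℕₚ.m≤m*n p (p ℕ.^ k))))

-- Dold sums

sum1to-cong : ∀ n {f g} → (∀ k → f (suc k) ≡ g (suc k)) → sum1to n f ≡ sum1to n g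
sum1to-cong zero    eq = refl
sum1to-cong (suc n) eq = cong₂ _+_ (sum1to-cong n eq) (eq n)

sum1to-+ : ∀ n f g → sum1to n (λ k → f k + g k) ≡ sum1to n f + sum1to n g
sum1to-+ zero    f g = refl
sum1to-+ (suc n) f g = trans (cong (_+ (f (suc n) + g (suc n))) (sum1to-+ n f g))
    (lem (sum1to n f) (sum1to n g) (f (suc n)) (g (suc n)))
  where
  lem : ∀ a b c d → a + b + (c + d) ≡ a + c + (b + d)
  lem = solve-∀

sum1to-*ˡ : ∀ n c f → sum1to n (λ k → c * f k) ≡ c * sum1to n f
sum1to-*ˡ zero    c f = sym (ℤₚ.*-zeroʳ c)
sum1to-*ˡ (suc n) c f = trans (cong (_+ c * f (suc n)) (sum1to-*ˡ n c f)) (sym (ℤₚ.*-distribˡ-+ c _ _))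

sum1to-≋0 : ∀ n {f m} → (∀ k → f (suc k) ≋ + 0 [ m ]) → sum1to n f ≋ + 0 [ m ]
sum1to-≋0 zero    eq = ≋-refl
sum1to-≋0 (suc n) eq = ≋-+ (sum1to-≋0 n eq) (eq n)

sum1to-extend : ∀ n k {f} → (∀ i → n ℕ.< i → f i ≡ + 0) → sum1to (k ℕ.+ n) f ≡ sum1to n f
sum1to-extend n zero    eq = refl
sum1to-extend n (suc k) {f} eq = trans (cong₂ _+_ (sum1to-extend n k eq) (eq _ (ℕ.s≤s (ℕₚ.m≤n+m n k))))
    (ℤₚ.+-identityʳ _)

unless-∣ : ℕ → (ℕ → ℤ) → ℕ → ℤ
unless-∣ p f d = if does (p ℕ∣.∣? d) then + 0 else f d

-- Prepares the pairing of d with p d. The upper bound is a multiple of p so that exactly the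
-- indices e ≤ n occur in the second sum.
sum1to-multiples : ∀ p .{{_ : NonZero p}} n f →
  sum1to (n ℕ.* p) f ≡ sum1to (n ℕ.* p) (unless-∣ p f) + sum1to n (λ e → f (p ℕ.* e))
sum1to-multiples p@(suc p′) n f = total n
  where
  g = unless-∣ p f
  X : ℕ → ℤ
  X n = sum1to n (λ e → f (p ℕ.* e))
  lem₁ : ∀ a x b → a + x + b ≡ a + b + x
  lem₁ = solve-∀
  lem₂ : ∀ a x b → a + x + b ≡ a + + 0 + (x + b)
  lem₂ = solve-∀
  -- `total` stands at a multiple of p, and `block` walks through the p - 1 indices that follow it.
  total : ∀ n → sum1to (n ℕ.* p) f ≡ sum1to (n ℕ.* p) g + X n
  block : ∀ n r → r ℕ.< p → sum1to (r ℕ.+ n ℕ.* p) f ≡ sum1to (r ℕ.+ n ℕ.* p) g + X n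
  total zero    = refl
  total (suc n) = trans (cong₂ _+_ (block n p′ (ℕₚ.n<1+n p′)) (cong f (ℕₚ.*-comm (suc n) p)))
    (trans (lem₂ (sum1to (p′ ℕ.+ n ℕ.* p) g) (X n) (f (p ℕ.* suc n)))
           (cong (λ z → sum1to (p′ ℕ.+ n ℕ.* p) g + z + X (suc n))
               (sym (if-yes (p ℕ∣.∣? suc n ℕ.* p) (ℕ∣.n∣m*n (suc n))))))
  block n zero    _   = total n
  block n (suc r) r<p = trans (cong (_+ f (suc r ℕ.+ n ℕ.* p)) (block n r (ℕₚ.<-trans (ℕₚ.n<1+n r) r<p)))
    (trans (lem₁ (sum1to (r ℕ.+ n ℕ.* p) g) (X n) (f (suc r ℕ.+ n ℕ.* p)))
           (cong (λ z → sum1to (r ℕ.+ n ℕ.* p) g + z + X n) (sym (if-no (p ℕ∣.∣? suc r ℕ.+ n ℕ.* p) λ d →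
             ℕ∣.>⇒∤ r<p (ℕ∣.∣m+n∣m⇒∣n (subst (p ℕ∣.∣_) (ℕₚ.+-comm (suc r) (n ℕ.* p)) d) (ℕ∣.n∣m*n n))))))

-- A named copy of the pattern-matching lambda inside `doldSum`, which cannot be referred to from
-- outside; `doldSum-terms` passes from one to the other pointwise.
doldTerm : (ℕ → ℤ) → ℕ → ℕ → ℤ
doldTerm A n zero    = + 0
doldTerm A n (suc k) = if does (suc k ℕ∣.∣? n) then μ (suc k) * A (n ℕ./ suc k) else + 0

doldSum-terms : ∀ A n → doldSum A n ≡ sum1to n (doldTerm A n)
doldSum-terms A n = sum1to-cong n λ _ → refl

doldTerm-yes : ∀ A q d .{{_ : NonZero d}} → doldTerm A (q ℕ.* d) d ≡ μ d * A q
doldTerm-yes A q d@(suc _) = trans (if-yes (d ℕ∣.∣? q ℕ.* d) (ℕ∣.n∣m*n q))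
    (cong (λ z → μ d * A z) (ℕ/.m*n/n≡m q d))

doldTerm-no : ∀ A n d → ¬ d ℕ∣.∣ n → doldTerm A n d ≡ + 0
doldTerm-no A n zero    _ = refl
doldTerm-no A n (suc k) d∤n = if-no (suc k ℕ∣.∣? n) d∤n

-- The divisors d and p d, with p ∤ d, contribute μ(d) (A(n / d) − A(n / (p d))).
doldSum-gauss : ∀ {A} → GaussCongruences A → ∀ {p} → Prime p → ∀ k m .{{_ : NonZero m}} →
  doldSum A (p ℕ.^ k ℕ.* m ℕ.* p) ≋ + 0 [ p ℕ.^ suc k ]
doldSum-gauss {A} gauss {p} pp k m =
  ≋-trans (≡⇒≋ (trans (doldSum-terms A (n′ ℕ.* p)) (trans (sum1to-multiples p n′ f)
     (trans (cong (_+ sum1to n′ (λ e → f (p ℕ.* e)))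
        (trans (cong (λ z → sum1to z g) (sym (ℕₚ.m∸n+n≡m (ℕₚ.m≤m*n n′ p))))
            (sum1to-extend n′ (n′ ℕ.* p ℕ.∸ n′) beyond)))
      (sym (sum1to-+ n′ g (λ e → f (p ℕ.* e))))))))
  (sum1to-≋0 n′ pair)
  where
  n′ = p ℕ.^ k ℕ.* m
  instance
    _ = prime⇒nonZero pp
    _ = ℕₚ.m^n≢0 p k
    _ = ℕₚ.m*n≢0 (p ℕ.^ k) m
  f = doldTerm A (n′ ℕ.* p)
  g = unless-∣ p f
  drop-p : ∀ e → ¬ p ℕ∣.∣ e → e ℕ∣.∣ n′ ℕ.* p → e ℕ∣.∣ n′
  drop-p e p∤e e∣ = coprime-divisor (coprime-prime pp p∤e) (subst (e ℕ∣.∣_) (ℕₚ.*-comm n′ p) e∣)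
  -- A divisor of `n′ * p` prime to p already divides n′. The sum over such divisors can thus be cut
  -- at n′ and matched index by index with the sum over the multiples of p.
  beyond : ∀ i → n′ ℕ.< i → g i ≡ + 0
  beyond i n′<i with p ℕ∣.∣? i
  ... | yes _  = refl
  ... | no p∤i = doldTerm-no A (n′ ℕ.* p) i λ d → ℕ∣.>⇒∤ n′<i (drop-p i p∤i d)
  pair : ∀ e′ → let e = suc e′ in g e + f (p ℕ.* e) ≋ + 0 [ p ℕ.^ suc k ]
  pair e′ with p ℕ∣.∣? suc e′
  -- Now p² divides `p * e`, so μ annihilates the only term left.
  ... | yes p∣e = ≡⇒≋ (cong (λ z → + 0 + z) vanish)
    where
    e = suc e′
    instance _ = ℕₚ.m*n≢0 p e
    vanish : f (p ℕ.* e) ≡ + 0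
    vanish with p ℕ.* e ℕ∣.∣? n′ ℕ.* p
    ... | no d∤ = doldTerm-no A (n′ ℕ.* p) (p ℕ.* e) d∤
    ... | yes (ℕ∣.divides q eq) = trans (cong (λ z → doldTerm A z (p ℕ.* e)) eq)
        (trans (doldTerm-yes A q (p ℕ.* e))
            (trans (cong (_* A q) (μ-square pp (p ℕ.* e) (ℕ∣.*-monoʳ-∣ p p∣e))) (ℤₚ.*-zeroˡ (A q))))
  ... | no p∤e with suc e′ ℕ∣.∣? n′
  ... | no e∤n′ = ≡⇒≋ (cong₂ _+_ (doldTerm-no A (n′ ℕ.* p) e λ d → e∤n′ (drop-p e p∤e d))
                                 (doldTerm-no A (n′ ℕ.* p) (p ℕ.* e) λ d → e∤n′
                                     (ℕ∣.*-cancelˡ-∣ p (subst (p ℕ.* e ℕ∣.∣_) (ℕₚ.*-comm n′ p) d))))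
    where e = suc e′
  -- Here e divides m, say m = c e. The two quotients are p q and q with q = pᵏ c, and the Gauss
  -- congruence compares A at these.
  ... | yes e∣n′ with ∣p^k*m⇒∣m pp p∤e k m e∣n′
  ... | ℕ∣.divides c eq = ≋-trans (≡⇒≋ (cong₂ _+_
          (trans (cong (λ z → doldTerm A z e) (trans (cong (ℕ._* p) eq-n′) (idx₁ q e p)))
              (doldTerm-yes A (p ℕ.* q) e))
          (trans (cong (λ z → doldTerm A z (p ℕ.* e)) (trans (cong (ℕ._* p) eq-n′) (idx₂ q e p)))
              (trans (doldTerm-yes A q (p ℕ.* e)) (cong (_* A q) (μ-prime-* pp e p∤e))))))
        (≋-trans (≋-+ (≋-* (≋-refl {μ e}) (subst (λ z → A z ≋ A q [ p ℕ.^ suc k ])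
            (ℕₚ.*-assoc p (p ℕ.^ k) c) (gauss pp k c))) ≋-refl) (≡⇒≋ (lem (μ e) (A q))))
    where
    e = suc e′
    q = p ℕ.^ k ℕ.* c
    instance _ = ℕₚ.m*n≢0 p e
    eq-n′ : n′ ≡ q ℕ.* e
    eq-n′ = trans (cong (p ℕ.^ k ℕ.*_) eq) (sym (ℕₚ.*-assoc (p ℕ.^ k) c e))
    idx₁ : ∀ q e p → q ℕ.* e ℕ.* p ≡ p ℕ.* q ℕ.* e
    idx₁ = ℕR.solve-∀
    idx₂ : ∀ q e p → q ℕ.* e ℕ.* p ≡ q ℕ.* (p ℕ.* e)
    idx₂ = ℕR.solve-∀
    lem : ∀ a b → a * b + - a * b ≡ + 0
    lem = solve-∀

gauss⇒dold : ∀ {A} → GaussCongruences A → Dold A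
gauss⇒dold {A} gauss n@(suc _) _ = prime-powers⇒∣ n ∣ doldSum A n ∣ local
  where
  local : ∀ {p} → Prime p → ∀ k → p ℕ.^ k ℕ∣.∣ n → p ℕ.^ k ℕ∣.∣ ∣ doldSum A n ∣
  local pp zero _ = ℕ∣.1∣ _
  local {p} pp (suc k) (ℕ∣.divides m@(suc _) eq) = ≋0⇒∣
      (subst (λ z → doldSum A z ≋ + 0 [ p ℕ.^ suc k ]) (trans (idx p (p ℕ.^ k) m) (sym eq))
      (doldSum-gauss gauss pp k m))
    where
    idx : ∀ p x m → x ℕ.* m ℕ.* p ≡ m ℕ.* (p ℕ.* x)
    idx = ℕR.solve-∀

-- At n = p only the divisors 1 and p contribute. Writing p as `1 * p` lets `sum1to-multiples`
-- separate them, with a single relevant index in each class.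
dold-prime : ∀ {A} → Dold A → ∀ {p} → Prime p → A p ≋ A 1 [ p ]
dold-prime {A} dold {p} pp = ∣⇒≋ (∣ᵤ⇒∣ (subst (λ z → p ℕ∣.∣ ∣ z ∣) eq
    (dold p (ℕ.>-nonZero⁻¹ p {{prime⇒nonZero pp}}))))
  where
  instance _ = prime⇒nonZero pp
  f = doldTerm A (1 ℕ.* p)
  g = unless-∣ p f
  lem : ∀ a b → + 0 + + 1 * a + (+ 0 + - + 1 * b) ≡ a - b
  lem = solve-∀
  beyond : ∀ i → 1 ℕ.< i → g i ≡ + 0
  beyond i 1<i with p ℕ∣.∣? i
  ... | yes _ = refl
  ... | no p∤i = doldTerm-no A (1 ℕ.* p) i λ d → ℕ∣.>⇒∤ 1<i
      (coprime-divisor (coprime-prime pp p∤i) (subst (i ℕ∣.∣_) (ℕₚ.*-comm 1 p) d))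
  eq : doldSum A p ≡ A p - A 1
  eq = trans (cong (doldSum A) (sym (ℕₚ.*-identityˡ p)))
      (trans (doldSum-terms A (1 ℕ.* p)) (trans (sum1to-multiples p 1 f)
    (trans (cong₂ _+_ (trans (cong (λ z → sum1to z g) (sym (ℕₚ.m∸n+n≡m (ℕₚ.m≤m*n 1 p))))
        (trans (sum1to-extend 1 (1 ℕ.* p ℕ.∸ 1) beyond)
                        (cong (λ z → + 0 + z) (trans (if-no (p ℕ∣.∣? 1) (λ d → ℕ∣.>⇒∤ (prime-2≤ pp) d))
                           (trans (cong (λ z → doldTerm A z 1) (ℕₚ.*-comm 1 p)) (doldTerm-yes A p 1))))))
                      (cong (λ z → + 0 + z) (trans (cong (λ z → doldTerm A z (p ℕ.* 1)) (ℕₚ.*-comm 1 p))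
                        (trans (cong (λ z → doldTerm A z (p ℕ.* 1)) (sym (ℕₚ.*-identityˡ (p ℕ.* 1))))
                        (trans (doldTerm-yes A 1 (p ℕ.* 1) {{ℕₚ.m*n≢0 p 1}})
                            (cong (_* A 1) (μ-prime-* pp 1 λ d → ℕ∣.>⇒∤ (prime-2≤ pp) d)))))))
           (lem (A p) (A 1)))))

doldSum-cong : ∀ {A B} → (∀ n → A n ≡ B n) → ∀ n → doldSum A n ≡ doldSum B n
doldSum-cong {A} {B} eq n = trans (doldSum-terms A n) (trans
    (sum1to-cong n λ k → cong (λ z → if does (suc k ℕ∣.∣? n) then μ (suc k) * z else + 0) (eq _))
    (sym (doldSum-terms B n)))

doldSum-*ˡ : ∀ c A n → doldSum (λ n → c * A n) n ≡ c * doldSum A n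
doldSum-*ˡ c A n = trans (doldSum-terms _ n) (trans (sum1to-cong n term)
    (trans (sum1to-*ˡ n c (doldTerm A n)) (cong (c *_) (sym (doldSum-terms A n)))))
  where
  lem : ∀ a b c → a * (c * b) ≡ c * (a * b)
  lem = solve-∀
  term : ∀ k → doldTerm (λ n → c * A n) n (suc k) ≡ c * doldTerm A n (suc k)
  term k = if-* (does (suc k ℕ∣.∣? n)) (lem (μ (suc k)) (A (n ℕ./ suc k)) c)
    where
    if-* : ∀ b {x y} → x ≡ c * y → (if b then x else + 0) ≡ c * (if b then y else + 0)
    if-* true  eq = eq
    if-* false eq = sym (ℤₚ.*-zeroʳ c)

dold-cong : ∀ {A B} → (∀ n → A n ≡ B n) → Dold A → Dold B
dold-cong eq dold n 1≤n = subst (λ z → n ℕ∣.∣ ∣ z ∣) (doldSum-cong eq n) (dold n 1≤n)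

dold-*ˡ : ∀ c {A} → Dold A → Dold (λ n → c * A n)
dold-*ˡ c {A} dold n 1≤n = subst (n ℕ∣.∣_) (sym (trans (cong ∣_∣ (doldSum-*ˡ c A n))
    (ℤₚ.abs-* c (doldSum A n)))) (ℕ∣.∣n⇒∣m*n ∣ c ∣ (dold n 1≤n))

-- Gauss sums

-- The operator Σ c(a) Tᵃ over a < k, with T the shift. On sequences of period k it is
-- multiplication by an element of the group ring of ℤ/k, and for c = χ this element is the Gauss
-- sum.
convolve : (ℕ → ℤ) → ℕ → (ℕ → ℤ) → ℕ → ℤ
convolve c k f n = Σ< k (λ a → c a * f (n ℕ.+ a))

convolve-cong : ∀ c k {f g} → (∀ n → f n ≡ g n) → ∀ n → convolve c k f n ≡ convolve c k g n
convolve-cong c k eq n = Σ<-cong k λ a _ → cong (c a *_) (eq (n ℕ.+ a))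

convolve-comm : ∀ c k l f n → convolve c k (convolve c l f) n ≡ convolve c l (convolve c k f) n
convolve-comm c k l f n = begin
  Σ< k (λ a → c a * Σ< l (λ b → c b * f (n ℕ.+ a ℕ.+ b)))
    ≡⟨ (Σ<-cong k λ a _ → sym (Σ<-*ˡ l (c a) _)) ⟩
  Σ< k (λ a → Σ< l (λ b → c a * (c b * f (n ℕ.+ a ℕ.+ b))))
    ≡⟨ Σ<-swap k l _ ⟩
  Σ< l (λ b → Σ< k (λ a → c a * (c b * f (n ℕ.+ a ℕ.+ b))))
    ≡⟨ (Σ<-cong l λ b _ → trans (Σ<-cong k λ a _ →
         trans (lem (c a) (c b) _) (cong (λ z → c b * (c a * f z)) (idx n a b))) (Σ<-*ˡ k (c b) _)) ⟩
  Σ< l (λ b → c b * Σ< k (λ a → c a * f (n ℕ.+ b ℕ.+ a))) ∎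
  where
  open ≡-Reasoning
  lem : ∀ a b x → a * (b * x) ≡ b * (a * x)
  lem = solve-∀
  idx : ∀ n a b → n ℕ.+ a ℕ.+ b ≡ n ℕ.+ b ℕ.+ a
  idx = ℕR.solve-∀

convolve^ : (ℕ → ℤ) → ℕ → ℕ → (ℕ → ℤ) → ℕ → ℤ
convolve^ c k zero    f = f
convolve^ c k (suc m) f = convolve c k (convolve^ c k m f)

convolve^-comm : ∀ c k l m f n → convolve^ c k m (convolve c l f) n ≡ convolve c l (convolve^ c k m f) n
convolve^-comm c k l zero    f n = refl
convolve^-comm c k l (suc m) f n =
  trans (convolve-cong c k (convolve^-comm c k l m f) n) (convolve-comm c k l (convolve^ c k m f) n)

-- Induction on the number of terms: Frobenius splits off the last one, with A the operator on the
-- indices below k and B = c(k) Tᵏ, whose j-th power is the factor c(k)ʲ with a shift by j k.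
convolve^-frobenius : ∀ {p} → Prime p → ∀ c k f n →
  convolve^ c k p f n ≋ Σ< k (λ a → c a ^ p * f (n ℕ.+ p ℕ.* a)) [ p ]
convolve^-frobenius {suc _} pp c zero f n = ≋-refl
convolve^-frobenius {p} pp c (suc k) f n =
  ≋-trans (≡⇒≋ (trans (cong (convolve^ c (suc k) p f) (sym (ℕₚ.+-identityʳ n))) (sym (ℤₚ.*-identityˡ _))))
  (≋-trans (frobenius pp {S} pascal)
  (≋-+ (≋-trans (≡⇒≋ (trans (ℤₚ.*-identityˡ _) (cong (convolve^ c k p f) (ℕₚ.+-identityʳ n))))
      (convolve^-frobenius pp c k f n))
       ≋-refl))
  where
  S : ℕ → ℕ → ℕ → ℤ
  S m i j = c k ^ j * convolve^ c k i (convolve^ c (suc k) m f) (n ℕ.+ j ℕ.* k)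
  pascal : Pascal S
  pascal m i j = trans (cong (c k ^ j *_) (convolve^-comm c k (suc k) i g (n ℕ.+ j ℕ.* k)))
    (trans (lem (c k ^ j) (convolve c k e (n ℕ.+ j ℕ.* k)) (c k) (e (n ℕ.+ j ℕ.* k ℕ.+ k)))
           (cong (λ z → c k ^ j * convolve c k e (n ℕ.+ j ℕ.* k) + c k * c k ^ j * e z) (idx n j k)))
    where
    g e : ℕ → ℤ
    g = convolve^ c (suc k) m f
    e = convolve^ c k i g
    lem : ∀ x a c b → x * (a + c * b) ≡ x * a + c * x * b
    lem = solve-∀
    idx : ∀ n j k → n ℕ.+ j ℕ.* k ℕ.+ k ≡ n ℕ.+ (k ℕ.+ j ℕ.* k)
    idx = ℕR.solve-∀

data Ternary : ℤ → Set where
  zero   : Ternary (+ 0)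
  one    : Ternary (+ 1)
  negone : Ternary -[1+ 0 ]

ternary-* : ∀ {x y} → Ternary x → Ternary y → Ternary (x * y)
ternary-* zero   y      = zero
ternary-* one    zero   = zero
ternary-* one    one    = one
ternary-* one    negone = negone
ternary-* negone zero   = zero
ternary-* negone one    = negone
ternary-* negone negone = one

ternary-odd-power : ∀ {x} → Ternary x → ∀ h → x ^ suc (h ℕ.+ h) ≡ x
ternary-odd-power {x} t zero = ℤₚ.*-identityʳ x
ternary-odd-power {x} t (suc h) rewrite ℕₚ.+-suc h h = trans
    (cong (λ z → x * (x * z)) (ternary-odd-power t h)) (cube t)
  where
  cube : ∀ {x} → Ternary x → x * (x * x) ≡ x
  cube zero   = refl
  cube one    = refl
  cube negone = refl

-- Two such values differ by at most 2. This recovers the exact value of a symbol from Euler's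
-- criterion modulo an odd prime.
ternary-≋⇒≡ : ∀ {x y m} → Ternary x → Ternary y → 3 ℕ.≤ m → x ≋ y [ m ] → x ≡ y
ternary-≋⇒≡ {x} {y} {m} tx ty 3≤m eq with ∣ x - y ∣ in abs | bound tx ty | ∣⇒∣ᵤ (≋⇒∣ eq)
  where
  bound : ∀ {x y} → Ternary x → Ternary y → ∣ x - y ∣ ℕ.≤ 2
  bound zero   zero   = ℕ.z≤n
  bound zero   one    = ℕ.s≤s ℕ.z≤n
  bound zero   negone = ℕ.s≤s ℕ.z≤n
  bound one    zero   = ℕ.s≤s ℕ.z≤n
  bound one    one    = ℕ.z≤n
  bound one    negone = ℕ.s≤s (ℕ.s≤s ℕ.z≤n)
  bound negone zero   = ℕ.s≤s ℕ.z≤n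
  bound negone one    = ℕ.s≤s (ℕ.s≤s ℕ.z≤n)
  bound negone negone = ℕ.z≤n
... | zero  | _   | _ = ℤₚ.i-j≡0⇒i≡j x y (ℤₚ.∣i∣≡0⇒i≡0 abs)
... | suc d | d≤2 | m∣ = contradiction (ℕ∣.∣⇒≤ m∣) (ℕₚ.<⇒≱ (ℕₚ.<-≤-trans (ℕ.s≤s d≤2) 3≤m))

-- Evaluates the p-th power of the Gauss sum at 0 both exactly and by Frobenius.
gauss-sum : ∀ χ m D → (∀ a → Ternary (χ a)) → (∀ a b → χ (a ℕ.* b) ≡ χ a * χ b) →
  (∀ n → convolve χ m (convolve χ m χ) n ≡ D * χ n) →
  ∀ h → let p = suc (h ℕ.+ h) in Prime p → ¬ p ℕ∣.∣ ∣ Σ< m (λ a → χ a * χ a) ∣ → D ^ h ≋ χ p [ p ]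
gauss-sum χ m D ternary χ-* square h pp p∤w = ≋-cancelˡ pp w p∤w
    (≋-trans (≡⇒≋ (sym exact)) (≋-trans (convolve^-frobenius pp χ m χ 0) (≡⇒≋ approx)))
  where
  p = suc (h ℕ.+ h)
  -- w is the value at 0 of the Gauss sum applied to χ. Both evaluations contain it: exactly one
  -- gets w Dʰ, and by Frobenius w χ(p), because χ(a)ᵖ = χ(a) for odd p and χ(p a) = χ(p) χ(a).
  w = Σ< m (λ a → χ a * χ a)
  even-power : ∀ h n → convolve^ χ m (h ℕ.+ h) χ n ≡ D ^ h * χ n
  even-power zero    n = sym (ℤₚ.*-identityˡ (χ n))
  even-power (suc h) n rewrite ℕₚ.+-suc h h = begin
    convolve χ m (convolve χ m (convolve^ χ m (h ℕ.+ h) χ)) n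
      ≡⟨ convolve-cong χ m (convolve-cong χ m (even-power h)) n ⟩
    convolve χ m (convolve χ m (λ n → D ^ h * χ n)) n
      ≡⟨ convolve-cong χ m (scale χ) n ⟩
    convolve χ m (λ n → D ^ h * convolve χ m χ n) n
      ≡⟨ scale (convolve χ m χ) n ⟩
    D ^ h * convolve χ m (convolve χ m χ) n
      ≡⟨ cong (D ^ h *_) (square n) ⟩
    D ^ h * (D * χ n)
      ≡⟨ lem (D ^ h) D (χ n) ⟩
    D * D ^ h * χ n ∎
    where
    open ≡-Reasoning
    lem : ∀ x d c → x * (d * c) ≡ d * x * c
    lem = solve-∀
    lem₂ : ∀ a x c → a * (x * c) ≡ x * (a * c)
    lem₂ = solve-∀
    scale : ∀ f n → convolve χ m (λ n → D ^ h * f n) n ≡ D ^ h * convolve χ m f n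
    scale f n = trans (Σ<-cong m λ a _ → lem₂ (χ a) (D ^ h) (f (n ℕ.+ a))) (Σ<-*ˡ m (D ^ h) _)
  lem₁ : ∀ a x → a * (x * a) ≡ x * (a * a)
  lem₁ = solve-∀
  exact : convolve^ χ m p χ 0 ≡ w * D ^ h
  exact = trans (convolve-cong χ m (even-power h) 0)
    (trans (Σ<-cong m λ a _ → lem₁ (χ a) (D ^ h)) (trans (Σ<-*ˡ m (D ^ h) _) (ℤₚ.*-comm (D ^ h) w)))
  approx : Σ< m (λ a → χ a ^ p * χ (p ℕ.* a)) ≡ w * χ p
  approx = trans (Σ<-cong m λ a _ → trans (cong₂ _*_ (ternary-odd-power (ternary a) h) (χ-* p a))
      (lem₁ (χ a) (χ p)))
    (trans (Σ<-*ˡ m (χ p) _) (ℤₚ.*-comm (χ p) w))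

-- Finite differences

-- Models a polynomial of degree at most k whose xᵏ-coefficient is c, possibly 0: the difference of
-- c xᵏ⁺¹ + ... is (k + 1) c xᵏ + ..., and the k-th difference is the constant k! c.
HasDegree : ℕ → ℤ → (ℕ → ℤ) → Set
HasDegree zero    c f = ∀ x → f x ≡ c
HasDegree (suc k) c f = HasDegree k (+ suc k * c) (λ x → f (suc x) - f x)

hasDegree-cong : ∀ k {c d f g} → c ≡ d → (∀ x → f x ≡ g x) → HasDegree k c f → HasDegree k d g
hasDegree-cong zero    refl eq deg x = trans (sym (eq x)) (deg x)
hasDegree-cong (suc k) refl eq deg   = hasDegree-cong k refl (λ x → cong₂ _-_ (eq (suc x)) (eq x)) deg

hasDegree-+ : ∀ k {c d f g} → HasDegree k c f → HasDegree k d g → HasDegree k (c + d) (λ x → f x + g x)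
hasDegree-+ zero    deg₁ deg₂ x = cong₂ _+_ (deg₁ x) (deg₂ x)
hasDegree-+ (suc k) {c} {d} {f} {g} deg₁ deg₂ =
  hasDegree-cong k (sym (ℤₚ.*-distribˡ-+ (+ suc k) c d)) (λ x → lem (f (suc x)) (f x) (g (suc x)) (g x))
      (hasDegree-+ k deg₁ deg₂)
  where
  lem : ∀ a b c d → a - b + (c - d) ≡ a + c - (b + d)
  lem = solve-∀

hasDegree-raise : ∀ k {c f} → HasDegree k c f → HasDegree (suc k) (+ 0) f
hasDegree-raise zero {c} deg x = trans (cong₂ _-_ (deg (suc x)) (deg x)) (ℤₚ.i≡j⇒i-j≡0 {c} refl)
hasDegree-raise (suc k) {f = f} deg =
  hasDegree-cong (suc k) {f = λ x → f (suc x) - f x} (sym (ℤₚ.*-zeroʳ (+ suc (suc k)))) (λ _ → refl)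
      (hasDegree-raise k deg)

hasDegree-x* : ∀ k {c f} → HasDegree k c f → HasDegree (suc k) c (λ x → + x * f x)
hasDegree-x* zero {c} {f} deg x = trans (cong₂ (λ a b → + suc x * a - + x * b) (deg (suc x)) (deg x))
    (lem (+ x) c)
  where
  lem : ∀ x c → (+ 1 + x) * c - x * c ≡ + 1 * c
  lem = solve-∀
hasDegree-x* (suc k) {c} {f} deg =
  -- The difference of x f(x) is x g + g + f with g the difference of f; the middle term has lower
  -- degree and adds 0 to the leading coefficient.
  hasDegree-cong (suc k) (lem₁ (+ suc k) c) (λ x → lem₂ (+ x) (f (suc x)) (f x))
    (hasDegree-+ (suc k) {f = λ x → + x * (f (suc x) - f x) + (f (suc x) - f x)}
      (hasDegree-+ (suc k) {f = λ x → + x * (f (suc x) - f x)} (hasDegree-x* k deg) (hasDegree-raise k deg))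
          deg)
  where
  lem₁ : ∀ k c → k * c + + 0 + c ≡ (+ 1 + k) * c
  lem₁ = solve-∀
  lem₂ : ∀ x a b → x * (a - b) + (a - b) + b ≡ (+ 1 + x) * a - x * b
  lem₂ = solve-∀

hasDegree-power : ∀ k → HasDegree k (+ 1) (λ x → (+ x) ^ k)
hasDegree-power zero    _ = refl
hasDegree-power (suc k)   = hasDegree-x* k (hasDegree-power k)

-- The k-th difference is a combination of the k + 1 values at consecutive points. This plays the
-- part of the bound on the number of roots modulo a prime.
hasDegree-vanish : ∀ k {c f m} a → HasDegree k c f → (∀ i → i ℕ.≤ k → f (a ℕ.+ i) ≋ + 0 [ m ]) →
  + (k !) * c ≋ + 0 [ m ]
hasDegree-vanish zero {c} {f} a deg van =
  ≋-trans (≡⇒≋ (trans (ℤₚ.*-identityˡ c) (sym (deg (a ℕ.+ 0))))) (van 0 ℕ.z≤n)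
hasDegree-vanish (suc k) {c} {f} {m} a deg van =
  ≋-trans (≡⇒≋ (trans (cong (_* c) (ℤₚ.pos-* (suc k) (k !))) (lem (+ suc k) (+ (k !)) c)))
    (hasDegree-vanish k a deg λ i i≤k → ≋-+ (subst (λ z → f z ≋ + 0 [ m ]) (ℕₚ.+-suc a i)
        (van (suc i) (ℕ.s≤s i≤k)))
                                            (≋-neg (van i (ℕₚ.m≤n⇒m≤1+n i≤k))))
  where
  lem : ∀ s f c → s * f * c ≡ f * (s * c)
  lem = solve-∀

prime∤! : ∀ {p} → Prime p → ∀ k → k ℕ.< p → ¬ p ℕ∣.∣ k !
prime∤! pp zero    k<p d = ℕ∣.>⇒∤ (prime-2≤ pp) d
prime∤! pp (suc k) k<p d with euclidsLemma (suc k) (k !) pp d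
... | inj₁ p∣k  = ℕ∣.>⇒∤ k<p p∣k
... | inj₂ p∣k! = prime∤! pp k (ℕₚ.<-trans (ℕₚ.n<1+n k) k<p) p∣k!

-- Periodic sums

%-≋ : ∀ a m .{{_ : NonZero m}} → + (a ℕ.% m) ≋ + a [ m ]
%-≋ a m = ≋-sym (mod (+ (a ℕ./ m)) (trans (cong +_ (trans (ℕ/.m≡m%n+[m/n]*n a m)
    (cong (a ℕ.% m ℕ.+_) (ℕₚ.*-comm (a ℕ./ m) m))))
  (cong (λ z → + (a ℕ.% m) + z) (ℤₚ.pos-* m (a ℕ./ m)))))

residue-unique : ∀ {a b m} → a ℕ.< m → b ℕ.< m → + a ≋ + b [ m ] → a ≡ b
residue-unique {a} {b} {m} a<m b<m eq with ∣ + a - + b ∣ in abs | bound | ∣⇒∣ᵤ (≋⇒∣ eq)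
  where
  bound : ∣ + a - + b ∣ ℕ.< m
  bound = ℕₚ.≤-<-trans (subst (λ z → ∣ z ∣ ℕ.≤ a ℕ.⊔ b) (sym (ℤₚ.m-n≡m⊖n a b)) (ℤₚ.∣m⊝n∣≤m⊔n a b))
      (ℕₚ.⊔-lub a<m b<m)
... | zero  | _   | _  = ℤₚ.+-injective (ℤₚ.i-j≡0⇒i≡j (+ a) (+ b) (ℤₚ.∣i∣≡0⇒i≡0 abs))
... | suc d | d<m | m∣ = contradiction m∣ (ℕ∣.>⇒∤ d<m)

Periodic : ℕ → (ℕ → ℤ) → Set
Periodic m f = ∀ {a b} → + a ≋ + b [ m ] → f a ≡ f b

Σ<-unique : ∀ n {f} a₀ → a₀ ℕ.< n → (∀ a → a ℕ.< n → a ≢ a₀ → f a ≡ + 0) → Σ< n f ≡ f a₀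
Σ<-unique (suc n) {f} a₀ (ℕ.s≤s a₀≤n) van with ℕₚ.m≤n⇒m<n∨m≡n a₀≤n
... | inj₁ a₀<n = trans (cong₂ _+_ (Σ<-unique n a₀ a₀<n λ a a<n → van a (ℕₚ.m<n⇒m<1+n a<n))
    (van n (ℕₚ.n<1+n n) λ e → ℕₚ.<⇒≢ a₀<n (sym e)))
                        (ℤₚ.+-identityʳ (f a₀))
... | inj₂ refl = trans (cong (_+ f n) (Σ<-zero n λ a a<n → van a (ℕₚ.m<n⇒m<1+n a<n) (ℕₚ.<⇒≢ a<n)))
    (ℤₚ.+-identityˡ (f n))

Σ<-shift : ∀ m {f} → Periodic m f → ∀ n → Σ< m (λ a → f (n ℕ.+ a)) ≡ Σ< m f
Σ<-shift m per zero = refl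
Σ<-shift m {f} per (suc n) = trans (+-cancelˡ (g 0) _ _ (begin
  g 0 + Σ< m (λ a → f (suc n ℕ.+ a))
    ≡⟨ cong (λ z → g 0 + z) (Σ<-cong m λ a _ → cong f (sym (ℕₚ.+-suc n a))) ⟩
  g 0 + Σ< m (λ a → g (suc a))
    ≡⟨ sym (Σ<-suc m g) ⟩
  Σ< m g + g m
    ≡⟨ cong (λ z → Σ< m g + z) (per (mod (+ 1) (lem (+ n) (+ m)))) ⟩
  Σ< m g + g 0
    ≡⟨ ℤₚ.+-comm (Σ< m g) (g 0) ⟩
  g 0 + Σ< m g ∎)) (Σ<-shift m per n)
  where
  open ≡-Reasoning
  g : ℕ → ℤ
  g a = f (n ℕ.+ a)
  lem : ∀ n m → n + m ≡ n + + 0 + m * + 1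
  lem = solve-∀

prime-inverse : ∀ {p} → Prime p → ∀ u → ¬ p ℕ∣.∣ u → ∃ λ v → + u * + v ≋ + 1 [ p ]
prime-inverse {suc (suc n)} pp u p∤u = u ℕ.^ n , ≋-cancelˡ pp (+ u) p∤u
  (≋-trans (≡⇒≋ (cong (λ z → + u * (+ u * z)) (pos-^ n)))
      (≋-trans (fermat pp (+ u)) (≡⇒≋ (sym (ℤₚ.*-identityʳ (+ u))))))
  where
  pos-^ : ∀ n → + (u ℕ.^ n) ≡ (+ u) ^ n
  pos-^ zero    = refl
  pos-^ (suc n) = trans (ℤₚ.pos-* u (u ℕ.^ n)) (cong (+ u *_) (pos-^ n))
prime-inverse {1} pp = contradiction pp ¬prime[1]
prime-inverse {0} pp = contradiction pp ¬prime[0]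

-- Reindexing along a ↦ u a without permutations: both sides count the pairs (a , b) with u a ≡ b.
Σ<-scale : ∀ {p} → Prime p → ∀ {f} → Periodic p f → ∀ u → ¬ p ℕ∣.∣ u → Σ< p (λ a → f (u ℕ.* a)) ≡ Σ< p f
Σ<-scale {p} pp {f} per u p∤u = begin
  Σ< p (λ a → f (u ℕ.* a))
    ≡⟨ Σ<-cong p (λ a _ → sym (row a)) ⟩
  Σ< p (λ a → Σ< p (t a))
    ≡⟨ Σ<-swap p p t ⟩
  Σ< p (λ b → Σ< p (λ a → t a b))
    ≡⟨ Σ<-cong p column ⟩
  Σ< p f ∎
  where
  open ≡-Reasoning
  instance _ = prime⇒nonZero pp
  test : ∀ a b → Dec (p ℕ∣.∣ ∣ + (u ℕ.* a) - + b ∣)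
  test a b = p ℕ∣.∣? ∣ + (u ℕ.* a) - + b ∣
  t : ℕ → ℕ → ℤ
  t a b = if does (test a b) then f b else + 0
  t-yes : ∀ a b → + (u ℕ.* a) ≋ + b [ p ] → t a b ≡ f b
  t-yes a b eq = if-yes (test a b) (∣⇒∣ᵤ (≋⇒∣ eq))
  t-no : ∀ a b → ¬ (+ (u ℕ.* a) ≋ + b [ p ]) → t a b ≡ + 0
  t-no a b neq = if-no (test a b) λ d → neq (∣⇒≋ (∣ᵤ⇒∣ d))
  row : ∀ a → Σ< p (t a) ≡ f (u ℕ.* a)
  row a = trans (Σ<-unique p b₀ (ℕ/.m%n<n (u ℕ.* a) p) λ b b<p b≢b₀ → t-no a b λ eq →
                   b≢b₀ (residue-unique b<p (ℕ/.m%n<n (u ℕ.* a) p)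
                       (≋-trans (≋-sym eq) (≋-sym (%-≋ (u ℕ.* a) p)))))
                (trans (t-yes a b₀ (≋-sym (%-≋ (u ℕ.* a) p))) (per (%-≋ (u ℕ.* a) p)))
    where b₀ = u ℕ.* a ℕ.% p
  column : ∀ b → b ℕ.< p → Σ< p (λ a → t a b) ≡ f b
  column b b<p with prime-inverse pp u p∤u
  ... | v , uv≋1 = trans (Σ<-unique p a₀ (ℕ/.m%n<n (v ℕ.* b) p) λ a a<p a≢a₀ → t-no a b λ eq →
                     a≢a₀ (residue-unique a<p (ℕ/.m%n<n (v ℕ.* b) p) (≋-cancelˡ pp (+ u) p∤u
                       (≋-trans (≡⇒≋ (sym (ℤₚ.pos-* u a)))
                           (≋-trans eq (≋-sym (≋-trans (≡⇒≋ (sym (ℤₚ.pos-* u a₀))) ua₀≋b)))))))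
                   (t-yes a₀ b ua₀≋b)
    where
    a₀ = v ℕ.* b ℕ.% p
    ua₀≋b : + (u ℕ.* a₀) ≋ + b [ p ]
    ua₀≋b = ≋-trans (≡⇒≋ (ℤₚ.pos-* u a₀)) (≋-trans (≋-* (≋-refl {+ u}) (%-≋ (v ℕ.* b) p))
      (≋-trans (≡⇒≋ (trans (cong (+ u *_) (ℤₚ.pos-* v b)) (sym (ℤₚ.*-assoc (+ u) (+ v) (+ b)))))
      (≋-trans (≋-* uv≋1 (≋-refl {+ b})) (≡⇒≋ (ℤₚ.*-identityˡ (+ b))))))

-- The Legendre symbol

*-^ : ∀ a b k → (a * b) ^ k ≡ a ^ k * b ^ k
*-^ a b zero    = refl
*-^ a b (suc k) = trans (cong (a * b *_) (*-^ a b k)) (lem a b (a ^ k) (b ^ k))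
  where
  lem : ∀ a b x y → a * b * (x * y) ≡ a * x * (b * y)
  lem = solve-∀

prime∣^⇒∣ : ∀ {p} → Prime p → ∀ a k → p ℕ∣.∣ a ℕ.^ k → p ℕ∣.∣ a
prime∣^⇒∣ pp a zero    d = contradiction d (ℕ∣.>⇒∤ (prime-2≤ pp))
prime∣^⇒∣ pp a (suc k) d = [ (λ p∣a → p∣a) , prime∣^⇒∣ pp a k ]′ (euclidsLemma a (a ℕ.^ k) pp d)

module Legendre (h : ℕ) (pq : Prime (suc (h ℕ.+ h))) where

  q : ℕ
  q = suc (h ℕ.+ h)

  3≤q : 3 ℕ.≤ q
  3≤q = bound h pq
    where
    bound : ∀ h → Prime (suc (h ℕ.+ h)) → 3 ℕ.≤ suc (h ℕ.+ h)
    bound zero    pq = contradiction pq ¬prime[1]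
    bound (suc h) pq = ℕ.s≤s (ℕ.s≤s (subst (1 ℕ.≤_) (sym (ℕₚ.+-suc h h)) (ℕ.s≤s ℕ.z≤n)))

  -- Defined by Euler's criterion instead of by squares: periodicity and multiplicativity then
  -- follow from those of aʰ, since `χ-determined` recovers the value from its class modulo q.
  χ : ℕ → ℤ
  χ a = if does (q ℕ∣.∣? a) then + 0 else (if does (q ℕ∣.∣? ∣ (+ a) ^ h - + 1 ∣) then + 1 else -[1+ 0 ])

  χ-ternary : ∀ a → Ternary (χ a)
  χ-ternary a with does (q ℕ∣.∣? a)
  ... | true = zero
  ... | false with does (q ℕ∣.∣? ∣ (+ a) ^ h - + 1 ∣)
  ... | true  = one
  ... | false = negone

  χ-zero : ∀ a → q ℕ∣.∣ a → χ a ≡ + 0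
  χ-zero a q∣a = if-yes (q ℕ∣.∣? a) q∣a

  χ-euler : ∀ a → (+ a) ^ h ≋ χ a [ q ]
  χ-euler a with q ℕ∣.∣? a
  ... | yes q∣a = ≋-trans (≋-^ (∣⇒≋0 q∣a) h) (≡⇒≋ (trans (zero^ h pq) (sym (χ-zero a q∣a))))
    where
    zero^ : ∀ h → Prime (suc (h ℕ.+ h)) → (+ 0) ^ h ≡ + 0
    zero^ zero    pq = contradiction pq ¬prime[1]
    zero^ (suc h) _  = refl
  ... | no q∤a with q ℕ∣.∣? ∣ (+ a) ^ h - + 1 ∣
  ... | yes d = ≋-trans (∣⇒≋ (∣ᵤ⇒∣ d)) (≡⇒≋ (sym (trans (if-no (q ℕ∣.∣? a) q∤a)
      (if-yes (q ℕ∣.∣? ∣ (+ a) ^ h - + 1 ∣) d))))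
  ... | no ¬d = ≋-trans (∣⇒≋ (∣ᵤ⇒∣ ([ (λ d → contradiction d ¬d) , (λ d → d) ]′
      (euclidsLemma ∣ A - + 1 ∣ ∣ A - -[1+ 0 ] ∣ pq
      (subst (q ℕ∣.∣_) (trans (cong ∣_∣ (lem A)) (ℤₚ.abs-* (A - + 1) (A - -[1+ 0 ]))) (∣⇒∣ᵤ (≋⇒∣ A²≋1)))))))
      (≡⇒≋ (sym (trans (if-no (q ℕ∣.∣? a) q∤a) (if-no (q ℕ∣.∣? ∣ A - + 1 ∣) ¬d))))
    where
    A = (+ a) ^ h
    lem : ∀ A → A * A - + 1 ≡ (A - + 1) * (A - -[1+ 0 ])
    lem = solve-∀
    A²≋1 : A * A ≋ + 1 [ q ]
    A²≋1 = ≋-cancelˡ pq (+ a) q∤a (≋-trans (≡⇒≋ (cong (+ a *_) (sym (ℤₚ.^-distribˡ-+-* (+ a) h h))))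
      (≋-trans (fermat pq (+ a)) (≡⇒≋ (sym (ℤₚ.*-identityʳ (+ a))))))

  χ-determined : ∀ a {x} → Ternary x → (+ a) ^ h ≋ x [ q ] → χ a ≡ x
  χ-determined a tx eq = ternary-≋⇒≡ (χ-ternary a) tx 3≤q (≋-trans (≋-sym (χ-euler a)) eq)

  χ-periodic : Periodic q χ
  χ-periodic {a} {b} eq = χ-determined a (χ-ternary b) (≋-trans (≋-^ eq h) (χ-euler b))

  χ-* : ∀ a b → χ (a ℕ.* b) ≡ χ a * χ b
  χ-* a b = χ-determined (a ℕ.* b) (ternary-* (χ-ternary a) (χ-ternary b))
    (≋-trans (≡⇒≋ (trans (cong (_^ h) (ℤₚ.pos-* a b)) (*-^ (+ a) (+ b) h))) (≋-* (χ-euler a) (χ-euler b)))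

  χ-1 : χ 1 ≡ + 1
  χ-1 = χ-determined 1 one (≡⇒≋ (ℤₚ.^-zeroˡ h))

  χ-square : ∀ a → ¬ q ℕ∣.∣ a → χ a * χ a ≡ + 1
  χ-square a q∤a with χ a | χ-ternary a | χ-euler a
  ... | _ | one    | _ = refl
  ... | _ | negone | _ = refl
  ... | _ | zero   | eq = contradiction (prime∣^⇒∣ pq a h (subst (q ℕ∣.∣_) (abs-^ h) (≋0⇒∣ eq))) q∤a
    where
    abs-^ : ∀ k → ∣ (+ a) ^ k ∣ ≡ a ℕ.^ k
    abs-^ zero    = refl
    abs-^ (suc k) = trans (ℤₚ.abs-* (+ a) ((+ a) ^ k)) (cong (a ℕ.*_) (abs-^ k))

  -- Otherwise xʰ ≡ 1 for 1 ≤ x ≤ 2h, so the h-th difference h! of xʰ vanishes mod q.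
  nonresidue : ∃ λ u → χ u ≡ -[1+ 0 ]
  nonresidue with ℕₚ.anyUpTo? (λ u → χ u ℤₚ.≟ -[1+ 0 ]) q
  ... | yes (u , _ , eq) = u , eq
  ... | no none = contradiction (vanish h refl) (λ eq → prime∤! pq h (ℕ.s≤s (ℕₚ.m≤m+n h h)) (≋0⇒∣ eq))
    where
    all-one : ∀ u → suc u ℕ.< q → χ (suc u) ≡ + 1
    all-one u u<q with χ (suc u) in eq | χ-ternary (suc u) | χ-square (suc u) (ℕ∣.>⇒∤ u<q)
    ... | _ | one    | _  = refl
    ... | _ | zero   | ()
    ... | _ | negone | _  = contradiction (suc u , u<q , eq) none
    vanish : ∀ k → k ≡ h → + (h !) ≋ + 0 [ q ]
    vanish zero    refl = contradiction pq ¬prime[1]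
    vanish (suc k) refl = ≋-trans (≡⇒≋ (trans (ℤₚ.pos-* (suc k) (k !)) (lem (+ suc k) (+ (k !)))))
      -- The argument is applied to the first difference of xʰ, which vanishes modulo q at x = 1,
      -- ..., k + 1. Its leading coefficient is `suc k`, and k! times this is h!.
      (hasDegree-vanish k 1 (hasDegree-power (suc k)) λ i i≤k →
        ≋-+ (power (suc i) (ℕ.s≤s (ℕ.s≤s (ℕₚ.≤-trans (ℕ.s≤s i≤k) (ℕₚ.m≤n+m (suc k) k)))))
            (≋-neg (power i (ℕ.s≤s (ℕₚ.≤-trans (ℕ.s≤s i≤k) (ℕₚ.m≤m+n (suc k) (suc k)))))))
      where
      lem : ∀ a b → a * b ≡ b * (a * + 1)
      lem = solve-∀
      power : ∀ i → suc i ℕ.< q → (+ suc i) ^ h ≋ + 1 [ q ]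
      power i i<q = ≋-trans (χ-euler (suc i)) (≡⇒≋ (all-one i i<q))

  Σχ≡0 : Σ< q χ ≡ + 0
  Σχ≡0 with nonresidue
  ... | u , χu≡-1 = self-neg (begin
    Σ< q χ
      ≡⟨ sym (Σ<-scale pq χ-periodic u (λ q∣u → contradiction (trans (sym χu≡-1) (χ-zero u q∣u)) λ ())) ⟩
    Σ< q (λ a → χ (u ℕ.* a))
      ≡⟨ (Σ<-cong q λ a _ → trans (χ-* u a) (cong (_* χ a) χu≡-1)) ⟩
    Σ< q (λ a → -[1+ 0 ] * χ a)
      ≡⟨ Σ<-*ˡ q -[1+ 0 ] χ ⟩
    -[1+ 0 ] * Σ< q χ ∎)
    where
    open ≡-Reasoning
    self-neg : ∀ {x} → x ≡ -[1+ 0 ] * x → x ≡ + 0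
    self-neg {+ zero}   _ = refl
    self-neg {+ suc n}  ()
    self-neg { -[1+ n ]} ()

  -- This is q · [q ∣ n] - 1: scaling by n shows that it is constant off the multiples of q, and its
  -- sum over a period, which is 0, forces that constant to be -1.
  autocorrelation : ℕ → ℤ
  autocorrelation = convolve χ q χ

  Σχ²≡q-1 : Σ< q (λ a → χ a * χ a) ≡ + (h ℕ.+ h)
  Σχ²≡q-1 = trans (Σ<-suc (h ℕ.+ h) (λ a → χ a * χ a)) (trans
      (cong₂ _+_ (cong (λ z → z * z) (χ-zero 0 (q ℕ∣.∣0)))
      (trans (Σ<-cong (h ℕ.+ h) λ a a<2h → χ-square (suc a) (ℕ∣.>⇒∤ (ℕ.s≤s a<2h))) (ones (h ℕ.+ h))))
    (ℤₚ.+-identityˡ _))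
    where
    ones : ∀ n → Σ< n (λ _ → + 1) ≡ + n
    ones zero    = refl
    ones (suc n) = trans (cong (λ z → z + + 1) (ones n)) (cong +_ (ℕₚ.+-comm n 1))

  autocorrelation-zero : ∀ n → q ℕ∣.∣ n → autocorrelation n ≡ + (h ℕ.+ h)
  autocorrelation-zero n q∣n = trans (Σ<-cong q λ a _ → cong (χ a *_) (χ-periodic (n+a≋a a))) Σχ²≡q-1
    where
    n+a≋a : ∀ a → + (n ℕ.+ a) ≋ + a [ q ]
    n+a≋a a = ≋-trans (≋-+ (∣⇒≋0 q∣n) (≋-refl {+ a})) (≡⇒≋ (ℤₚ.+-identityˡ (+ a)))

  autocorrelation-unit : ∀ n → ¬ q ℕ∣.∣ n → autocorrelation n ≡ autocorrelation 1
  autocorrelation-unit n q∤n = begin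
    Σ< q (λ a → χ a * χ (n ℕ.+ a))
      ≡⟨ sym (Σ<-scale pq (λ {a} {b} eq → cong₂ _*_ (χ-periodic eq) (χ-periodic (≋-+ (≋-refl {+ n}) eq))) n
          q∤n) ⟩
    Σ< q (λ a → χ (n ℕ.* a) * χ (n ℕ.+ n ℕ.* a))
      ≡⟨ (Σ<-cong q λ a _ → trans (cong₂ _*_ (χ-* n a) (trans (cong χ (sym (ℕₚ.*-suc n a))) (χ-* n (suc a))))
           (trans (lem (χ n) (χ a) (χ (suc a))) (trans (cong (_* (χ a * χ (suc a))) (χ-square n q∤n))
               (ℤₚ.*-identityˡ (χ a * χ (suc a)))))) ⟩
    Σ< q (λ a → χ a * χ (1 ℕ.+ a)) ∎
    where
    open ≡-Reasoning
    lem : ∀ n a b → n * a * (n * b) ≡ n * n * (a * b)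
    lem = solve-∀

  autocorrelation-sum : Σ< q autocorrelation ≡ + 0
  autocorrelation-sum = begin
    Σ< q (λ n → Σ< q (λ a → χ a * χ (n ℕ.+ a)))
      ≡⟨ Σ<-swap q q _ ⟩
    Σ< q (λ a → Σ< q (λ n → χ a * χ (n ℕ.+ a)))
      ≡⟨ (Σ<-cong q λ a _ → trans (Σ<-*ˡ q (χ a) _) (trans (cong (χ a *_)
           (trans (Σ<-cong q λ n _ → cong χ (ℕₚ.+-comm n a)) (trans (Σ<-shift q χ-periodic a) Σχ≡0)))
               (ℤₚ.*-zeroʳ (χ a)))) ⟩
    Σ< q (λ _ → + 0)
      ≡⟨ (Σ<-zero q λ _ _ → refl) ⟩
    + 0 ∎
    where open ≡-Reasoning

  autocorrelation-one : autocorrelation 1 ≡ -[1+ 0 ]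
  autocorrelation-one = solve-c h pq (autocorrelation 1) (begin
    + (h ℕ.+ h) + + (h ℕ.+ h) * autocorrelation 1
      ≡⟨ cong₂ _+_ (sym (autocorrelation-zero 0 (q ℕ∣.∣0))) (sym (trans
           (Σ<-cong (h ℕ.+ h) λ a a<2h → autocorrelation-unit (suc a) (ℕ∣.>⇒∤ (ℕ.s≤s a<2h)))
               (const (h ℕ.+ h)))) ⟩
    autocorrelation 0 + Σ< (h ℕ.+ h) (λ a → autocorrelation (suc a))
      ≡⟨ sym (Σ<-suc (h ℕ.+ h) autocorrelation) ⟩
    Σ< q autocorrelation
      ≡⟨ autocorrelation-sum ⟩
    + 0 ∎)
    where
    open ≡-Reasoning
    lem₁ : ∀ n c → n * c + c ≡ (+ 1 + n) * c
    lem₁ = solve-∀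
    const : ∀ n → Σ< n (λ _ → autocorrelation 1) ≡ + n * autocorrelation 1
    const zero    = refl
    const (suc n) = trans (cong (_+ autocorrelation 1) (const n)) (lem₁ (+ n) (autocorrelation 1))
    lem₂ : ∀ w c → w + w * c ≡ w * (c - -[1+ 0 ])
    lem₂ = solve-∀
    solve-c : ∀ h → Prime (suc (h ℕ.+ h)) → ∀ c → + (h ℕ.+ h) + + (h ℕ.+ h) * c ≡ + 0 → c ≡ -[1+ 0 ]
    solve-c zero    pq = contradiction pq ¬prime[1]
    solve-c (suc h) pq c eq with ℤₚ.i*j≡0⇒i≡0∨j≡0 (+ (suc h ℕ.+ suc h))
        (trans (sym (lem₂ (+ (suc h ℕ.+ suc h)) c)) eq)
    ... | inj₂ c+1≡0 = ℤₚ.i-j≡0⇒i≡j c -[1+ 0 ] c+1≡0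

  -- Since h + h = q - 1 represents -1, this is χ(-1) q, the square of the Gauss sum.
  D : ℤ
  D = χ (h ℕ.+ h) * + q

  gauss-sum-square : ∀ n → convolve χ q autocorrelation n ≡ D * χ n
  gauss-sum-square n = begin
    Σ< q (λ a → χ a * autocorrelation (n ℕ.+ a))
      ≡⟨ (Σ<-cong q λ a _ → trans (cong (χ a *_) (value (n ℕ.+ a))) (lem₁ (χ a) (δ (n ℕ.+ a)))) ⟩
    Σ< q (λ a → χ a * δ (n ℕ.+ a) + -[1+ 0 ] * χ a)
      ≡⟨ trans (Σ<-+ q _ _) (cong₂ _+_ (Σ<-unique q a₀ (ℕ/.m%n<n ((h ℕ.+ h) ℕ.* n) q) off)
          (trans (Σ<-*ˡ q -[1+ 0 ] χ) (cong (-[1+ 0 ] *_) Σχ≡0))) ⟩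
    χ a₀ * δ (n ℕ.+ a₀) + + 0
      ≡⟨ cong₂ (λ a b → a * b + + 0) (trans (χ-periodic (%-≋ ((h ℕ.+ h) ℕ.* n) q)) (χ-* (h ℕ.+ h) n))
          (if-yes (q ℕ∣.∣? n ℕ.+ a₀) (≋0⇒∣ n+a₀≋0)) ⟩
    χ (h ℕ.+ h) * χ n * + q + + 0
      ≡⟨ lem₂ (χ (h ℕ.+ h)) (χ n) (+ q) ⟩
    D * χ n ∎
    where
    open ≡-Reasoning
    δ : ℕ → ℤ
    δ k = if does (q ℕ∣.∣? k) then + q else + 0
    -- The residue of -n, the only index where the delta part of the autocorrelation is nonzero. The
    -- constant part -1 contributes nothing because Σχ = 0.
    a₀ = (h ℕ.+ h) ℕ.* n ℕ.% q
    lem₁ : ∀ a d → a * (d + -[1+ 0 ]) ≡ a * d + -[1+ 0 ] * a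
    lem₁ = solve-∀
    lem₂ : ∀ a b c → a * b * c + + 0 ≡ a * c * b
    lem₂ = solve-∀
    value : ∀ k → autocorrelation k ≡ δ k + -[1+ 0 ]
    value k with q ℕ∣.∣? k
    ... | yes q∣k = trans (autocorrelation-zero k q∣k) (cong (λ z → z + -[1+ 0 ])
        (sym (if-yes (q ℕ∣.∣? k) q∣k)))
    ... | no  q∤k = trans (trans (autocorrelation-unit k q∤k) autocorrelation-one)
        (cong (λ z → z + -[1+ 0 ]) (sym (if-no (q ℕ∣.∣? k) q∤k)))
    n+a₀≋0 : + (n ℕ.+ a₀) ≋ + 0 [ q ]
    n+a₀≋0 = ≋-trans (≋-+ (≋-refl {+ n}) (%-≋ ((h ℕ.+ h) ℕ.* n) q)) (∣⇒≋0 (ℕ∣.m∣m*n {q} n))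
    off : ∀ a → a ℕ.< q → a ≢ a₀ → χ a * δ (n ℕ.+ a) ≡ + 0
    off a a<q a≢a₀ = trans (cong (χ a *_) (if-no (q ℕ∣.∣? n ℕ.+ a) λ d → a≢a₀
        (residue-unique a<q (ℕ/.m%n<n ((h ℕ.+ h) ℕ.* n) q)
        (≋-trans (≡⇒≋ (lem₃ (+ n) (+ a))) (≋-trans (≋-+ (≋-trans (∣⇒≋0 d) (≋-sym n+a₀≋0)) (≋-refl { - + n}))
            (≡⇒≋ (sym (lem₃ (+ n) (+ a₀)))))))))
      (ℤₚ.*-zeroʳ (χ a))
      where
      lem₃ : ∀ n a → a ≡ n + a + - n
      lem₃ = solve-∀

  D-euler : ∀ k → let p = suc (k ℕ.+ k) in Prime p → ¬ p ℕ∣.∣ h ℕ.+ h → D ^ k ≋ χ p [ p ]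
  D-euler k pp p∤ = gauss-sum χ q D χ-ternary χ-* gauss-sum-square k pp λ d → p∤
      (subst (λ z → _ ℕ∣.∣ ∣ z ∣) Σχ²≡q-1 d)

-- Quadratic characters

-- ψ is the symbol (E / ·) away from finitely many primes.
record Character (E : ℤ) : Set where
  field
    ψ              : ℕ → ℤ
    period         : ℕ
    exceptional    : ℕ
    exceptional≢0  : NonZero exceptional
    ψ-ternary      : ∀ a → Ternary (ψ a)
    ψ-1            : ψ 1 ≡ + 1
    ψ-*            : ∀ a b → ψ (a ℕ.* b) ≡ ψ a * ψ b
    ψ-periodic     : Periodic period ψ
    -- This keeps an odd prime q that does not divide E out of the period, so that conditions modulo
    -- q and modulo the period can be imposed independently.
    period-primes  : ∀ {r} → Prime r → r ℕ∣.∣ period → r ≡ 2 ⊎ r ℕ∣.∣ ∣ E ∣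
    ψ-euler        : ∀ k → let p = suc (k ℕ.+ k) in Prime p → ¬ p ℕ∣.∣ exceptional → E ^ k ≋ ψ p [ p ]

≋-coarsen : ∀ {a b m n} → m ℕ∣.∣ n → a ≋ b [ n ] → a ≋ b [ m ]
≋-coarsen {b = b} {m} (ℕ∣.divides c refl) (mod k refl) = mod (+ c * k)
    (trans (cong (λ z → b + z * k) (ℤₚ.pos-* c m)) (lem b (+ c) (+ m) k))
  where
  lem : ∀ b c m k → b + c * m * k ≡ b + m * (c * k)
  lem = solve-∀

trivial-character : Character (+ 1)
trivial-character = record
  { ψ = λ _ → + 1 ; period = 1 ; exceptional = 1 ; exceptional≢0 = _
  ; ψ-ternary = λ _ → one ; ψ-1 = refl ; ψ-* = λ _ _ → refl ; ψ-periodic = λ _ → refl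
  ; period-primes = λ pr r∣1 → contradiction r∣1 (ℕ∣.>⇒∤ (prime-2≤ pr))
  ; ψ-euler = λ k _ _ → ≡⇒≋ (ℤₚ.^-zeroˡ k)
  }

_⊗_ : ∀ {E F} → Character E → Character F → Character (E * F)
_⊗_ {E} {F} c d = record
  { ψ = λ a → C.ψ a * D.ψ a
  ; period = C.period ℕ.* D.period
  ; exceptional = C.exceptional ℕ.* D.exceptional
  ; exceptional≢0 = ℕₚ.m*n≢0 C.exceptional D.exceptional {{C.exceptional≢0}} {{D.exceptional≢0}}
  ; ψ-ternary = λ a → ternary-* (C.ψ-ternary a) (D.ψ-ternary a)
  ; ψ-1 = cong₂ _*_ C.ψ-1 D.ψ-1
  ; ψ-* = λ a b → trans (cong₂ _*_ (C.ψ-* a b) (D.ψ-* a b)) (lem (C.ψ a) (C.ψ b) (D.ψ a) (D.ψ b))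
  ; ψ-periodic = λ eq → cong₂ _*_ (C.ψ-periodic (≋-coarsen (ℕ∣.m∣m*n D.period) eq))
      (D.ψ-periodic (≋-coarsen (ℕ∣.n∣m*n C.period) eq))
  ; period-primes = λ pr r∣ → [ (λ r∣c → map₂ (λ z → subst (_ ℕ∣.∣_) (sym (ℤₚ.abs-* E F))
      (ℕ∣.∣m⇒∣m*n ∣ F ∣ z)) (C.period-primes pr r∣c))
                              , (λ r∣d → map₂ (λ z → subst (_ ℕ∣.∣_) (sym (ℤₚ.abs-* E F))
                                  (ℕ∣.∣n⇒∣m*n ∣ E ∣ z)) (D.period-primes pr r∣d)) ]′
                                  (euclidsLemma C.period D.period pr r∣)
  ; ψ-euler = λ k pp p∤ → ≋-trans (≡⇒≋ (*-^ E F k)) (≋-*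
      (C.ψ-euler k pp λ z → p∤ (ℕ∣.∣m⇒∣m*n D.exceptional z))
      (D.ψ-euler k pp λ z → p∤ (ℕ∣.∣n⇒∣m*n C.exceptional z)))
  }
  where
  module C = Character c
  module D = Character d
  lem : ∀ a b c d → a * b * (c * d) ≡ a * c * (b * d)
  lem = solve-∀

step⇒periodic : ∀ m .{{_ : NonZero m}} {f} → (∀ a → f (m ℕ.+ a) ≡ f a) → Periodic m f
step⇒periodic m {f} step {a} {b} eq = trans (reduce a) (trans
    (cong f (residue-unique (ℕ/.m%n<n a m) (ℕ/.m%n<n b m)
    (≋-trans (%-≋ a m) (≋-trans eq (≋-sym (%-≋ b m)))))) (sym (reduce b)))
  where
  steps : ∀ k a → f (a ℕ.+ k ℕ.* m) ≡ f a
  steps zero    a = cong f (ℕₚ.+-identityʳ a)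
  steps (suc k) a = trans (cong f (idx a m (k ℕ.* m))) (trans (step (a ℕ.+ k ℕ.* m)) (steps k a))
    where
    idx : ∀ a m x → a ℕ.+ (m ℕ.+ x) ≡ m ℕ.+ (a ℕ.+ x)
    idx = ℕR.solve-∀
  reduce : ∀ a → f a ≡ f (a ℕ.% m)
  reduce a = trans (cong f (ℕ/.m≡m%n+[m/n]*n a m)) (steps (a ℕ./ m) (a ℕ.% m))

periodic-* : ∀ m .{{_ : NonZero m}} {f} → Periodic m f →
  (∀ {a} → a ℕ.< m → ∀ {b} → b ℕ.< m → f (a ℕ.* b) ≡ f a * f b) → ∀ a b → f (a ℕ.* b) ≡ f a * f b
periodic-* m {f} per small a b = trans (per (≋-trans (≡⇒≋ (ℤₚ.pos-* a b))
    (≋-trans (≋-sym (≋-* (%-≋ a m) (%-≋ b m))) (≡⇒≋ (sym (ℤₚ.pos-* (a ℕ.% m) (b ℕ.% m)))))))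
  (trans (small (ℕ/.m%n<n a m) (ℕ/.m%n<n b m)) (cong₂ _*_ (per (%-≋ a m)) (per (%-≋ b m))))

χ₄ : ℕ → ℤ
χ₄ 0 = + 0
χ₄ 1 = + 1
χ₄ 2 = + 0
χ₄ 3 = -[1+ 0 ]
χ₄ (suc (suc (suc (suc n)))) = χ₄ n

χ₄-ternary : ∀ n → Ternary (χ₄ n)
χ₄-ternary 0 = zero
χ₄-ternary 1 = one
χ₄-ternary 2 = zero
χ₄-ternary 3 = negone
χ₄-ternary (suc (suc (suc (suc n)))) = χ₄-ternary n

χ₄-odd : ∀ k → -[1+ 0 ] ^ k ≡ χ₄ (suc (k ℕ.+ k))
χ₄-odd 0 = refl
χ₄-odd 1 = refl
χ₄-odd (suc (suc k)) rewrite ℕₚ.+-suc k (suc k) | ℕₚ.+-suc k k = trans (lem (-[1+ 0 ] ^ k)) (χ₄-odd k)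
  where
  lem : ∀ x → -[1+ 0 ] * (-[1+ 0 ] * x) ≡ x
  lem = solve-∀

character[-1] : Character -[1+ 0 ]
character[-1] = record
  { ψ = χ₄ ; period = 4 ; exceptional = 1 ; exceptional≢0 = _
  ; ψ-ternary = χ₄-ternary
  ; ψ-1 = refl
  ; ψ-* = periodic-* 4 χ₄-periodic (toWitness {a? = ℕₚ.allUpTo?
      (λ a → ℕₚ.allUpTo? (λ b → χ₄ (a ℕ.* b) ℤₚ.≟ χ₄ a * χ₄ b) 4) 4} _)
  ; ψ-periodic = χ₄-periodic
  ; period-primes = λ pr r∣4 → inj₁ (prime∣prime⇒≡ pr prime[2]
      ([ (λ z → z) , (λ z → z) ]′ (euclidsLemma 2 2 pr r∣4)))
  ; ψ-euler = λ k _ _ → ≡⇒≋ (χ₄-odd k)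
  }
  where
  χ₄-periodic : Periodic 4 χ₄
  χ₄-periodic = step⇒periodic 4 λ _ → refl

χ₈ : ℕ → ℤ
χ₈ 0 = + 0
χ₈ 1 = + 1
χ₈ 2 = + 0
χ₈ 3 = -[1+ 0 ]
χ₈ 4 = + 0
χ₈ 5 = -[1+ 0 ]
χ₈ 6 = + 0
χ₈ 7 = + 1
χ₈ (suc (suc (suc (suc (suc (suc (suc (suc n)))))))) = χ₈ n

χ₈-ternary : ∀ n → Ternary (χ₈ n)
χ₈-ternary 0 = zero
χ₈-ternary 1 = one
χ₈-ternary 2 = zero
χ₈-ternary 3 = negone
χ₈-ternary 4 = zero
χ₈-ternary 5 = negone
χ₈-ternary 6 = zero
χ₈-ternary 7 = one
χ₈-ternary (suc (suc (suc (suc (suc (suc (suc (suc n)))))))) = χ₈-ternary n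

-- The Gauss sum of χ₈ has square 8. Both sides are invariant under n ↦ n + 8 by computation, so
-- eight evaluations suffice.
χ₈-square : ∀ n → convolve χ₈ 8 (convolve χ₈ 8 χ₈) n ≡ + 8 * χ₈ n
χ₈-square 0 = refl
χ₈-square 1 = refl
χ₈-square 2 = refl
χ₈-square 3 = refl
χ₈-square 4 = refl
χ₈-square 5 = refl
χ₈-square 6 = refl
χ₈-square 7 = refl
χ₈-square (suc (suc (suc (suc (suc (suc (suc (suc n)))))))) = χ₈-square n

prime-unit-power : ∀ k → let p = suc (k ℕ.+ k) in Prime p → ∀ a → ¬ p ℕ∣.∣ ∣ a ∣ → (a * a) ^ k ≋ + 1 [ p ]
prime-unit-power k pp a p∤a = ≋-cancelˡ pp a p∤a (≋-trans
    (≡⇒≋ (cong (a *_) (trans (*-^ a a k) (sym (ℤₚ.^-distribˡ-+-* a k k)))))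
  (≋-trans (fermat pp a) (≡⇒≋ (sym (ℤₚ.*-identityʳ a)))))

character[2] : Character (+ 2)
character[2] = record
  { ψ = χ₈ ; period = 8 ; exceptional = 2 ; exceptional≢0 = _
  ; ψ-ternary = χ₈-ternary
  ; ψ-1 = refl
  ; ψ-* = χ₈-*
  ; ψ-periodic = χ₈-periodic
  ; period-primes = λ pr r∣8 → inj₁ (prime∣prime⇒≡ pr prime[2]
      ([ (λ z → z) , (λ r∣4 → [ (λ z → z) , (λ z → z) ]′ (euclidsLemma 2 2 pr r∣4)) ]′
          (euclidsLemma 2 4 pr r∣8)))
  ; ψ-euler = euler
  }
  where
  χ₈-periodic : Periodic 8 χ₈
  χ₈-periodic = step⇒periodic 8 λ _ → refl
  χ₈-* : ∀ a b → χ₈ (a ℕ.* b) ≡ χ₈ a * χ₈ b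
  χ₈-* = periodic-* 8 χ₈-periodic (toWitness {a? = ℕₚ.allUpTo?
      (λ a → ℕₚ.allUpTo? (λ b → χ₈ (a ℕ.* b) ℤₚ.≟ χ₈ a * χ₈ b) 8) 8} _)
  euler : ∀ k → let p = suc (k ℕ.+ k) in Prime p → ¬ p ℕ∣.∣ 2 → (+ 2) ^ k ≋ χ₈ p [ p ]
  -- The Gauss sum gives the symbol of 8 = 4 · 2, and 4ᵏ ≡ 1. The factor to be cancelled is Σχ₈² =
  -- 4.
  euler k pp p∤2 = ≋-trans (≡⇒≋ (sym (ℤₚ.*-identityˡ _)))
      (≋-trans (≋-* (≋-sym (prime-unit-power k pp (+ 2) p∤2)) (≋-refl {(+ 2) ^ k}))
    (≋-trans (≡⇒≋ (sym (*-^ (+ 4) (+ 2) k)))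
      (gauss-sum χ₈ 8 (+ 8) χ₈-ternary χ₈-* χ₈-square k pp λ p∣4 → p∤2
          ([ (λ z → z) , (λ z → z) ]′ (euclidsLemma 2 2 pp p∣4)))))

module _ (h : ℕ) (pq : Prime (suc (h ℕ.+ h))) where
  open Legendre h pq

  legendre-sign : ℤ
  legendre-sign = χ (h ℕ.+ h)

  2h-nonZero : NonZero (h ℕ.+ h)
  2h-nonZero = go h pq
    where
    go : ∀ h → Prime (suc (h ℕ.+ h)) → NonZero (h ℕ.+ h)
    go zero    pq = contradiction pq ¬prime[1]
    go (suc h) _  = _

  legendre-sign²≡1 : legendre-sign * legendre-sign ≡ + 1
  legendre-sign²≡1 = χ-square (h ℕ.+ h) (ℕ∣.>⇒∤ {{2h-nonZero}} (ℕₚ.n<1+n (h ℕ.+ h)))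

  legendre-character : Character D
  legendre-character = record
    -- The primes dividing q - 1 are set aside because `gauss-sum` cancels Σχ² = q - 1.
    { ψ = χ ; period = q ; exceptional = h ℕ.+ h ; exceptional≢0 = 2h-nonZero
    ; ψ-ternary = χ-ternary ; ψ-1 = χ-1 ; ψ-* = χ-* ; ψ-periodic = χ-periodic
    ; period-primes = λ pr r∣q → inj₂ (subst (_ ℕ∣.∣_) (sym (ℤₚ.abs-* legendre-sign (+ q)))
        (ℕ∣.∣n⇒∣m*n ∣ legendre-sign ∣ r∣q))
    ; ψ-euler = D-euler
    }

  sign-character : Character legendre-sign
  sign-character with χ (h ℕ.+ h) | χ-ternary (h ℕ.+ h) | legendre-sign²≡1
  ... | _ | one    | _ = trivial-character
  ... | _ | negone | _ = character[-1]
  ... | _ | zero   | ()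

  -- With ε = χ(-1) the Gauss sum yields the symbol of ε q. As ε² = 1, multiplying by the symbol of
  -- ε, which is χ₄ when ε = -1, gives that of q: this is quadratic reciprocity.
  odd-prime-character : Character (+ q)
  odd-prime-character = subst Character (trans (sym (ℤₚ.*-assoc legendre-sign legendre-sign (+ q)))
    (trans (cong (_* + q) legendre-sign²≡1) (ℤₚ.*-identityˡ (+ q)))) (sign-character ⊗ legendre-character)

character : ∀ E → E ≢ + 0 → Character E
character (+ 0)       E≢0 = contradiction refl E≢0
character (+ n@(suc _)) _ = subst (λ z → Character (+ z)) (sym (PrimeFactorisation.isFactorisation F))
    (product-character (PrimeFactorisation.factorsPrime F))
  where
  F = factorise n
  prime-character : ∀ {p} → Prime p → Character (+ p)
  prime-character {p} pp with p ℕ.≟ 2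
  ... | yes refl = character[2]
  ... | no p≢2 with prime-odd pp p≢2
  ... | h , refl = odd-prime-character h pp
  product-character : ∀ {ps} → All Prime ps → Character (+ product ps)
  product-character []        = trivial-character
  product-character {p ∷ ps} (pp ∷ pps) = subst Character (sym (ℤₚ.pos-* p (product ps)))
      (prime-character pp ⊗ product-character pps)
character -[1+ n ] _ = subst Character (ℤₚ.-1*i≡-i (+ suc n)) (character[-1] ⊗ character (+ suc n) λ ())

-- Integers that are quadratic residues modulo almost all primes

ResidueOutside : ℕ → ℤ → Set
ResidueOutside N E = ∀ k → let p = suc (k ℕ.+ k) in Prime p → ¬ p ℕ∣.∣ N → E ^ k ≋ + 1 [ p ]

module _ {E : ℤ} (c : Character E) {N : ℕ} (residue : ResidueOutside N E) where
  open Character c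

  -- The factor 2 leaves only odd primes, which have the form `suc (k + k)` and are at least 3, so
  -- that values of ψ can be read off modulo p.
  bad : ℕ
  bad = 2 ℕ.* (N ℕ.* exceptional)

  bad≢0 : .{{_ : NonZero N}} → NonZero bad
  bad≢0 = ℕₚ.m*n≢0 2 (N ℕ.* exceptional)
    where
    instance
      _ = exceptional≢0
      _ = ℕₚ.m*n≢0 N exceptional

  -- At each prime factor p of n the power of E with exponent (p - 1)/2 is congruent both to ψ(p)
  -- and to 1. Hence ψ(p) = 1, and multiplicativity carries this to n.
  no-negative-value : ∀ n .{{_ : NonZero n}} → (∀ {p} → Prime p → p ℕ∣.∣ n → ¬ p ℕ∣.∣ bad) → ψ n ≢ -[1+ 0 ]
  no-negative-value n good ψn≡-1 = contradiction (trans (sym ψn≡-1) (trans (cong ψ isFactorisation)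
      (ψ-product factorsPrime λ pp p∣ → good pp (subst (_ ℕ∣.∣_) (sym isFactorisation) p∣)))) λ ()
    where
    open PrimeFactorisation (factorise n)
    ψ-prime : ∀ {p} → Prime p → ¬ p ℕ∣.∣ bad → ψ p ≡ + 1
    ψ-prime {p} pp p∤bad with prime-odd pp (λ { refl → p∤bad (ℕ∣.m∣m*n (N ℕ.* exceptional)) })
    ... | k , refl = ternary-≋⇒≡ (ψ-ternary p) one (Legendre.3≤q k pp)
          (≋-trans (≋-sym (ψ-euler k pp λ d → p∤bad (ℕ∣.∣n⇒∣m*n 2 (ℕ∣.∣n⇒∣m*n N d))))
                   (residue k pp λ d → p∤bad (ℕ∣.∣n⇒∣m*n 2 (ℕ∣.∣m⇒∣m*n exceptional d))))
    ψ-product : ∀ {ps} → All Prime ps → (∀ {p} → Prime p → p ℕ∣.∣ product ps → ¬ p ℕ∣.∣ bad) →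
      ψ (product ps) ≡ + 1
    ψ-product []         _    = ψ-1
    ψ-product {p ∷ ps} (pp ∷ pps) good = trans (ψ-* p (product ps))
      (cong₂ _*_ (ψ-prime pp (good pp (ℕ∣.m∣m*n (product ps))))
          (ψ-product pps λ pr d → good pr (ℕ∣.∣n⇒∣m*n p d)))

prime∤1+multiple : ∀ {p L n} → Prime p → + n ≋ + 1 [ L ] → p ℕ∣.∣ n → ¬ p ℕ∣.∣ L
prime∤1+multiple pp n≋1 p∣n p∣L = ℕ∣.>⇒∤ (prime-2≤ pp) (≋0⇒∣ (≋-trans (≋-sym (≋-coarsen p∣L n≋1)) (∣⇒≋0 p∣n)))

1+-≋ : ∀ L t → + suc (L ℕ.* t) ≋ + 1 [ L ]
1+-≋ L t = mod (+ t) (cong (λ z → + 1 + z) (ℤₚ.pos-* L t))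

-- Take n ≡ 1 modulo the period of F and modulo the bad primes other than q, and n a nonresidue mod q.
odd-prime-impossible : ∀ h (pq : Prime (suc (h ℕ.+ h))) → let q = suc (h ℕ.+ h) in
  ∀ F → F ≢ + 0 → ¬ q ℕ∣.∣ ∣ F ∣ → ∀ {N} .{{_ : NonZero N}} → ¬ ResidueOutside N (F * + q)
odd-prime-impossible h pq F F≢0 q∤F {N} residue = impossible nonresidue
    (prime-split pq (bad c residue′) {{bad≢0 c residue′}})
  where
  open Legendre h pq
  ε = legendre-sign h pq
  εF≢0 : ε * F ≢ + 0
  εF≢0 εF≡0 = F≢0 (begin
    F            ≡⟨ sym (ℤₚ.*-identityˡ F) ⟩
    + 1 * F      ≡⟨ cong (_* F) (sym (legendre-sign²≡1 h pq)) ⟩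
    ε * ε * F    ≡⟨ ℤₚ.*-assoc ε ε F ⟩
    ε * (ε * F)  ≡⟨ cong (ε *_) εF≡0 ⟩
    ε * + 0      ≡⟨ ℤₚ.*-zeroʳ ε ⟩
    + 0          ∎)
    where open ≡-Reasoning
  -- F q is rewritten as (ε q)(ε F): the first factor has exactly χ as its symbol, and the second
  -- has a period prime to q.
  d = character (ε * F) εF≢0
  c = legendre-character h pq ⊗ d
  module d = Character d
  residue′ : ResidueOutside N (D * (ε * F))
  residue′ = subst (ResidueOutside N) (begin
    F * + q              ≡⟨ sym (ℤₚ.*-identityˡ (F * + q)) ⟩
    + 1 * (F * + q)      ≡⟨ cong (_* (F * + q)) (sym (legendre-sign²≡1 h pq)) ⟩
    ε * ε * (F * + q)    ≡⟨ lem ε F (+ q) ⟩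
    ε * + q * (ε * F)    ∎) residue
    where
    open ≡-Reasoning
    lem : ∀ e f q → e * e * (f * q) ≡ e * q * (e * f)
    lem = solve-∀
  q∤period : ¬ q ℕ∣.∣ d.period
  q∤period q∣ with d.period-primes pq q∣
  ... | inj₁ q≡2 = ℕₚ.<⇒≢ 3≤q (sym q≡2)
  ... | inj₂ q∣εF = q∤F (subst (q ℕ∣.∣_) (ℕₚ.*-identityˡ ∣ F ∣)
      (subst (λ z → q ℕ∣.∣ z ℕ.* ∣ F ∣) (ℕₚ.m*n≡1⇒m≡1 ∣ ε ∣ ∣ ε ∣
      (trans (sym (ℤₚ.abs-* ε ε)) (cong ∣_∣ (legendre-sign²≡1 h pq))))
                   (subst (q ℕ∣.∣_) (ℤₚ.abs-* ε F) q∣εF)))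
  impossible : (∃ λ u → χ u ≡ -[1+ 0 ]) → PrimeSplit q (bad c residue′) → ⊥
  impossible (u , χu≡-1) (k , M , bad≡ , q∤M) = no-negative-value c residue′ n good (begin
    χ n * d.ψ n  ≡⟨ cong₂ _*_ χn≡-1 (d.ψ-periodic (≋-coarsen (ℕ∣.m∣m*n M) (1+-≋ L t))) ⟩
    -[1+ 0 ] * d.ψ 1 ≡⟨ cong (-[1+ 0 ] *_) d.ψ-1 ⟩
    -[1+ 0 ]     ∎)
    where
    open ≡-Reasoning
    L = d.period ℕ.* M
    q∤L : ¬ q ℕ∣.∣ L
    q∤L q∣L = [ q∤period , q∤M ]′ (euclidsLemma d.period M pq q∣L)
    v = proj₁ (prime-inverse pq L q∤L)
    -- v inverts L modulo q and h + h stands for -1, so 1 + L t ≡ 1 + (u - 1) = u modulo q.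
    t = v ℕ.* (u ℕ.+ (h ℕ.+ h))
    n = suc (L ℕ.* t)
    lem₁ : ∀ l v x → + 1 + l * (v * x) ≡ + 1 + l * v * x
    lem₁ = solve-∀
    lem₂ : ∀ u w → + 1 + + 1 * (u + w) ≡ u + (+ 1 + w) * + 1
    lem₂ = solve-∀
    n≋u : + n ≋ + u [ q ]
    n≋u = ≋-trans (≡⇒≋ (trans (cong (λ z → + 1 + z) (trans (ℤₚ.pos-* L t)
        (cong (+ L *_) (ℤₚ.pos-* v (u ℕ.+ (h ℕ.+ h)))))) (lem₁ (+ L) (+ v) (+ (u ℕ.+ (h ℕ.+ h))))))
      (≋-trans (≋-+ (≋-refl {+ 1}) (≋-* (proj₂ (prime-inverse pq L q∤L)) (≋-refl {+ (u ℕ.+ (h ℕ.+ h))})))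
               (mod (+ 1) (lem₂ (+ u) (+ (h ℕ.+ h)))))
    χn≡-1 : χ n ≡ -[1+ 0 ]
    χn≡-1 = trans (χ-periodic n≋u) χu≡-1
    good : ∀ {p} → Prime p → p ℕ∣.∣ n → ¬ p ℕ∣.∣ bad c residue′
    good {p} pp p∣n p∣bad with euclidsLemma (q ℕ.^ k) M pp (subst (p ℕ∣.∣_) bad≡ p∣bad)
    ... | inj₂ p∣M = prime∤1+multiple pp (1+-≋ L t) p∣n (ℕ∣.∣n⇒∣m*n d.period p∣M)
    ... | inj₁ p∣q^k = contradiction (trans (sym χn≡-1)
        (χ-zero n (subst (ℕ∣._∣ n) (prime∣prime⇒≡ pp pq (prime∣^⇒∣ pp q k p∣q^k)) p∣n))) λ ()

-- The witness is 4 · `bad` - 1: it is prime to `bad` and congruent to 3 modulo 4, where χ₄ is -1.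
-- Matching `bad` as `suc b` writes it as 3 + 4b without subtraction.
minus-one-impossible : ∀ {N} .{{_ : NonZero N}} → ¬ ResidueOutside N -[1+ 0 ]
minus-one-impossible {N} residue = impossible (bad character[-1] residue) {{bad≢0 character[-1] residue}} refl
  where
  impossible : ∀ b .{{_ : NonZero b}} → b ≡ bad character[-1] residue → ⊥
  impossible (suc b) eq = no-negative-value character[-1] residue (3 ℕ.+ b ℕ.* 4) good
      (Character.ψ-periodic character[-1] {3 ℕ.+ b ℕ.* 4} {3}
      (mod (+ b) (cong (λ z → + 3 + z) (trans (ℤₚ.pos-* b 4) (ℤₚ.*-comm (+ b) (+ 4))))))
    where
    idx : ∀ b → 3 ℕ.+ b ℕ.* 4 ℕ.+ 1 ≡ 4 ℕ.* suc b
    idx = ℕR.solve-∀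
    good : ∀ {p} → Prime p → p ℕ∣.∣ 3 ℕ.+ b ℕ.* 4 → ¬ p ℕ∣.∣ bad character[-1] residue
    good {p} pp p∣n p∣bad = ℕ∣.>⇒∤ (prime-2≤ pp) (ℕ∣.∣m+n∣m⇒∣n
        (subst (p ℕ∣.∣_) (sym (idx b)) (ℕ∣.∣n⇒∣m*n 4 (subst (p ℕ∣.∣_) (sym eq) p∣bad))) p∣n)

module _ {ε : ℤ} (c : Character ε) (ψ[1+4a]≡1 : ∀ a → Character.ψ c (suc (4 ℕ.* a)) ≡ + 1) where

  -- With M the odd part of `bad`, the witness 1 + 4M is odd, prime to M and congruent to 5 modulo
  -- 8, where χ₈ is -1. Being 1 modulo 4, it has value 1 under the character of ε.
  two-impossible : ∀ {N} .{{_ : NonZero N}} → ¬ ResidueOutside N (ε * + 2)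
  two-impossible residue with prime-split prime[2] (bad (c ⊗ character[2]) residue)
      {{bad≢0 (c ⊗ character[2]) residue}}
  ... | k , M , bad≡ , 2∤M with even⊎odd M
  ... | inj₁ (j , refl) = 2∤M (2∣h+h j)
  ... | inj₂ (j , refl) = no-negative-value (c ⊗ character[2]) residue n good
      (cong₂ _*_ (ψ[1+4a]≡1 M) (Character.ψ-periodic character[2] {n} {5}
          (mod (+ j) (trans (cong +_ (idx j)) (cong (λ z → + 5 + z) (ℤₚ.pos-* 8 j))))))
    where
    n = suc (4 ℕ.* M)
    idx : ∀ j → suc (4 ℕ.* suc (j ℕ.+ j)) ≡ 5 ℕ.+ 8 ℕ.* j
    idx = ℕR.solve-∀
    good : ∀ {p} → Prime p → p ℕ∣.∣ n → ¬ p ℕ∣.∣ bad (c ⊗ character[2]) residue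
    good {p} pp p∣n p∣bad = prime∤1+multiple pp (1+-≋ (4 ℕ.* M) 1)
        (subst (λ z → p ℕ∣.∣ suc z) (sym (ℕₚ.*-identityʳ (4 ℕ.* M))) p∣n)
      ([ (λ d → subst (ℕ∣._∣ 4 ℕ.* M) (sym (prime∣prime⇒≡ pp prime[2] (prime∣^⇒∣ pp 2 k d)))
          (ℕ∣.∣m⇒∣m*n M (ℕ∣.divides 2 refl)))
       , (λ d → ℕ∣.∣n⇒∣m*n 4 d) ]′ (euclidsLemma (2 ℕ.^ k) M pp (subst (p ℕ∣.∣_) bad≡ p∣bad)))

residue-square-quotient : ∀ {N} q E → ResidueOutside N (E * (+ q * + q)) → ResidueOutside (N ℕ.* q) E
residue-square-quotient {N} q E residue k pp p∤ =
  ≋-trans (≡⇒≋ (sym (ℤₚ.*-identityʳ (E ^ k))))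
  (≋-trans (≋-* (≋-refl {E ^ k}) (≋-sym (prime-unit-power k pp (+ q) λ d → p∤ (ℕ∣.∣n⇒∣m*n N d))))
  (≋-trans (≡⇒≋ (sym (*-^ E (+ q * + q) k))) (residue k pp λ d → p∤ (ℕ∣.∣m⇒∣m*n q d))))

ℕ∣⇒factor : ∀ {m} E → m ℕ∣.∣ ∣ E ∣ → ∃ λ F → E ≡ F * + m
ℕ∣⇒factor {m} E m∣E with ∣ᵤ⇒∣ {+ m} {E} m∣E
... | divides F eq = F , eq

-- Square factors r² are removed by descent on the absolute value of E; N varies along the descent,
-- since each removal adds r to the primes set aside. A squarefree E other than 1 has an odd prime
-- factor or is -1, 2 or -2, and each case is excluded by its own witness.
residue-everywhere⇒square : ∀ E → E ≢ + 0 → ∀ N .{{_ : NonZero N}} → ResidueOutside N E → ∃ λ k → k * k ≡ E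
residue-everywhere⇒square E E≢0 N@(suc _) residue = <-rec Goal step ∣ E ∣ E refl E≢0 N _ residue
  where
  Goal : ℕ → Set
  Goal m = ∀ E → ∣ E ∣ ≡ m → E ≢ + 0 → ∀ N → NonZero N → ResidueOutside N E → ∃ λ k → k * k ≡ E

  squarefree : ∀ E → E ≢ + 0 → ∀ N → NonZero N → ResidueOutside N E →
    (∀ {r} → Prime r → ¬ r ℕ.* r ℕ∣.∣ ∣ E ∣) → ∃ λ k → k * k ≡ E
  squarefree E E≢0 N N≢0 residue sf = cases ∣ E ∣ refl
    where
    instance _ = N≢0
    odd-divisor : ∀ {r} → Prime r → r ≢ 2 → ¬ r ℕ∣.∣ ∣ E ∣
    odd-divisor {r} pr r≢2 r∣E with ℕ∣⇒factor E r∣E | prime-odd pr r≢2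
    ... | F , refl | h , refl = odd-prime-impossible h pr F (λ { refl → E≢0 refl })
            (λ r∣F → sf pr (subst (r ℕ.* r ℕ∣.∣_) (sym (ℤₚ.abs-* F (+ r))) (ℕ∣.*-monoˡ-∣ r r∣F))) residue
    unit-2 : ∀ F → ∣ F ∣ ≡ 1 → E ≢ F * + 2
    unit-2 (+ 1)    refl refl = two-impossible trivial-character (λ _ → refl) {N} residue
    unit-2 -[1+ 0 ] refl refl = two-impossible character[-1]
        (λ a → Character.ψ-periodic character[-1] {suc (4 ℕ.* a)} {1} (1+-≋ 4 a)) {N} residue
    only-2 : ∀ F → E ≡ F * + 2 → ∀ m → ∣ F ∣ ≡ m → ⊥
    only-2 F refl 0 ∣F∣≡0 = E≢0 (cong (_* + 2) (ℤₚ.∣i∣≡0⇒i≡0 {F} ∣F∣≡0))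
    only-2 F eq   1 ∣F∣≡1 = unit-2 F ∣F∣≡1 eq
    only-2 F eq m@(suc (suc _)) ∣F∣≡m with prime-divisor m (ℕ.s≤s (ℕ.s≤s ℕ.z≤n))
    ... | r , pr , r∣m with r ℕ.≟ 2
    ... | yes refl = sf prime[2] (subst (4 ℕ∣.∣_) (sym (trans (cong ∣_∣ eq) (ℤₚ.abs-* F (+ 2))))
        (ℕ∣.*-monoˡ-∣ 2 (subst (2 ℕ∣.∣_) (sym ∣F∣≡m) r∣m)))
    ... | no r≢2 = odd-divisor pr r≢2 (subst (r ℕ∣.∣_) (sym (trans (cong ∣_∣ eq) (ℤₚ.abs-* F (+ 2))))
        (ℕ∣.∣m⇒∣m*n 2 (subst (r ℕ∣.∣_) (sym ∣F∣≡m) r∣m)))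
    unit : ∀ E → ∣ E ∣ ≡ 1 → ResidueOutside N E → ∃ λ k → k * k ≡ E
    unit (+ 1)    refl _       = + 1 , refl
    unit -[1+ 0 ] refl residue = contradiction residue (minus-one-impossible {N})
    cases : ∀ m → ∣ E ∣ ≡ m → ∃ λ k → k * k ≡ E
    cases 0 ∣E∣≡0 = contradiction (ℤₚ.∣i∣≡0⇒i≡0 ∣E∣≡0) E≢0
    cases 1 ∣E∣≡1 = unit E ∣E∣≡1 residue
    cases m@(suc (suc _)) ∣E∣≡m with prime-divisor m (ℕ.s≤s (ℕ.s≤s ℕ.z≤n))
    ... | r , pr , r∣m with r ℕ.≟ 2
    ... | no r≢2 = contradiction (subst (r ℕ∣.∣_) (sym ∣E∣≡m) r∣m) (odd-divisor pr r≢2)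
    ... | yes refl with ℕ∣⇒factor E (subst (2 ℕ∣.∣_) (sym ∣E∣≡m) r∣m)
    ... | F , eq = ⊥-elim (only-2 F eq ∣ F ∣ refl)

  step : ∀ m → (∀ {m′} → m′ ℕ.< m → Goal m′) → Goal m
  step m rec E ∣E∣≡m E≢0 N N≢0 residue with ℕₚ.anyUpTo? (λ r → prime? r ×-dec r ℕ.* r ℕ∣.∣? ∣ E ∣) (suc ∣ E ∣)
  ... | no none = squarefree E E≢0 N N≢0 residue λ {r} pr rr∣E → none
      (r , ℕ.s≤s (ℕ∣.∣⇒≤ {{∣E∣≢0}} (ℕ∣.∣-trans (ℕ∣.m∣m*n r) rr∣E)) , pr , rr∣E)
    where
    ∣E∣≢0 : NonZero ∣ E ∣
    ∣E∣≢0 = ℕ.≢-nonZero λ eq → E≢0 (ℤₚ.∣i∣≡0⇒i≡0 eq)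
  ... | yes (r , _ , pr , rr∣E) with ℕ∣⇒factor E rr∣E
  ... | F , refl = root (rec smaller F refl F≢0 (N ℕ.* r) (ℕₚ.m*n≢0 N r)
      (residue-square-quotient r F (subst (λ z → ResidueOutside N (F * z)) (ℤₚ.pos-* r r) residue)))
    where
    instance
      _ = N≢0
      _ = prime⇒nonZero pr
    F≢0 : F ≢ + 0
    F≢0 refl = E≢0 refl
    instance
      _ = ℕ.≢-nonZero {∣ F ∣} λ eq → F≢0 (ℤₚ.∣i∣≡0⇒i≡0 eq)
    smaller : ∣ F ∣ ℕ.< m
    smaller = subst (∣ F ∣ ℕ.<_) (trans (sym (ℤₚ.abs-* F (+ (r ℕ.* r)))) ∣E∣≡m)
        (ℕₚ.m<m*n ∣ F ∣ (r ℕ.* r) (ℕₚ.≤-trans (prime-2≤ pr) (ℕₚ.m≤m*n r r)))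
    lem : ∀ k r → k * r * (k * r) ≡ k * k * (r * r)
    lem = solve-∀
    root : (∃ λ k → k * k ≡ F) → ∃ λ k → k * k ≡ F * + (r ℕ.* r)
    root (k , refl) = k * + r , trans (lem k (+ r)) (cong (k * k *_) (sym (ℤₚ.pos-* r r)))

-- Dold multiples of second order sequences

module _ (r s : ℤ) (U : ℕ → ℤ) (rec : Recurrence r s U) where

  -- κ ranges over all nonzero integers to cover both the positive constant of (1) and the possibly
  -- negative coefficient of (3). The primes to be set aside are those dividing K = κ (2U₁ - rU₀),
  -- by which the congruence at p is cancelled.
  almostDold-obstruction : (∀ k → k * k ≢ r * r + + 4 * s) →
    ∀ κ → κ ≢ + 0 → Dold (λ n → κ * U n) → + 2 * U 1 ≡ r * U 0
  almostDold-obstruction nonsquare κ κ≢0 dold with (+ 2 * U 1 - r * U 0) ℤₚ.≟ + 0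
  ... | yes X≡0 = ℤₚ.i-j≡0⇒i≡j _ _ X≡0
  ... | no X≢0 = contradiction (proj₂ square) (nonsquare (proj₁ square))
    where
    X = + 2 * U 1 - r * U 0
    Δ = r * r + + 4 * s
    K = κ * X
    K≢0 : K ≢ + 0
    K≢0 K≡0 = [ κ≢0 , X≢0 ]′ (ℤₚ.i*j≡0⇒i≡0∨j≡0 κ K≡0)
    instance _ = ℕ.≢-nonZero {∣ K ∣} λ eq → K≢0 (ℤₚ.∣i∣≡0⇒i≡0 eq)
    residue : ResidueOutside ∣ K ∣ Δ
    residue k pp p∤K = ≋-cancelˡ pp K p∤K (≋-sym
      (≋-trans (≡⇒≋ (lem₁ κ r (U 0) (U 1)))
      (≋-trans (≋-+ (≋-* (≋-refl {+ 2}) (≋-sym (dold-prime dold pp))) (≋-refl { - (κ * (r * U 0))}))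
      (≋-trans (≡⇒≋ (lem₂ κ (U p) (r * U 0)))
      (≋-trans (≋-+ (≋-* (≋-refl {κ}) (recurrence-at-prime r s U rec k pp)) (≋-refl { - (κ * (r * U 0))}))
      (≡⇒≋ (lem₃ κ (r * U 0) (Δ ^ k) X)))))))
      where
      p = suc (k ℕ.+ k)
      lem₁ : ∀ κ r a b → κ * (+ 2 * b - r * a) * + 1 ≡ + 2 * (κ * b) + - (κ * (r * a))
      lem₁ = solve-∀
      lem₂ : ∀ κ u v → + 2 * (κ * u) + - (κ * v) ≡ κ * (+ 2 * u) + - (κ * v)
      lem₂ = solve-∀
      lem₃ : ∀ κ v d x → κ * (v + d * x) + - (κ * v) ≡ κ * x * d
      lem₃ = solve-∀
    square : ∃ λ k → k * k ≡ Δ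
    square = residue-everywhere⇒square Δ (λ Δ≡0 → nonsquare (+ 0) (sym Δ≡0)) ∣ K ∣ residue

  proportional-to-trace : + 2 * U 1 ≡ r * U 0 → ∀ n → + 2 * U n ≡ U 0 * trace r (- s) n
  proportional-to-trace eq zero       = ℤₚ.*-comm (+ 2) (U 0)
  proportional-to-trace eq (suc zero) = trans eq (ℤₚ.*-comm r (U 0))
  proportional-to-trace eq (suc (suc n)) = begin
    + 2 * U (suc (suc n))
      ≡⟨ cong (+ 2 *_) (rec n) ⟩
    + 2 * (r * U (suc n) + s * U n)
      ≡⟨ lem₁ r s (U (suc n)) (U n) ⟩
    r * (+ 2 * U (suc n)) + s * (+ 2 * U n)
      ≡⟨ cong₂ (λ a b → r * a + s * b) (proportional-to-trace eq (suc n)) (proportional-to-trace eq n) ⟩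
    r * (U 0 * trace r (- s) (suc n)) + s * (U 0 * trace r (- s) n)
      ≡⟨ lem₂ r s (U 0) (trace r (- s) (suc n)) (trace r (- s) n) ⟩
    U 0 * (r * trace r (- s) (suc n) + - - s * trace r (- s) n) ∎
    where
    open ≡-Reasoning
    lem₁ : ∀ r s a b → + 2 * (r * a + s * b) ≡ r * (+ 2 * a) + s * (+ 2 * b)
    lem₁ = solve-∀
    lem₂ : ∀ r s u a b → r * (u * a) + s * (u * b) ≡ u * (r * a + - - s * b)
    lem₂ = solve-∀

  -- The factor 2 clears the denominator of U = (U₀ / 2) V, so that 2c U is the integer multiple c
  -- U₀ of the trace sequence V.
  dold-double-multiple : + 2 * U 1 ≡ r * U 0 → ∀ c → Dold (λ n → + 2 * c * U n)
  dold-double-multiple eq c = dold-cong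
    (λ n → trans (ℤₚ.*-assoc c (U 0) (trace r (- s) n))
        (trans (cong (c *_) (sym (proportional-to-trace eq n))) (lem c (U n))))
    (dold-*ˡ (c * U 0) {trace r (- s)} (gauss⇒dold (trace-gauss r (- s))))
    where
    lem : ∀ c u → c * (+ 2 * u) ≡ + 2 * c * u
    lem = solve-∀

-- Nonvanishing of the radical

prod2to-≢0 : ∀ n {f} → (∀ i → f i ≢ + 0) → prod2to n f ≢ + 0
prod2to-≢0 zero          _   = λ ()
prod2to-≢0 (suc zero)    _   = λ ()
prod2to-≢0 (suc (suc n)) f≢0 eq = [ prod2to-≢0 (suc n) f≢0 , f≢0 (suc (suc n)) ]′ (ℤₚ.i*j≡0⇒i≡0∨j≡0 _ eq)

rad-≢0 : ∀ m → rad m ≢ + 0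
rad-≢0 m = prod2to-≢0 ∣ m ∣ factor≢0
  where
  factor≢0 : ∀ p → (if does (prime? p) then (if does (p ℕ∣.∣? ∣ m ∣) then + p else + 1) else + 1) ≢ + 0
  factor≢0 p with prime? p
  ... | no _ = λ ()
  ... | yes pp with does (p ℕ∣.∣? ∣ m ∣)
  ... | false = λ ()
  ... | true  = λ { refl → ¬prime[0] pp }

-- Coordinates in ℚ(√Δ)

ι : ℤ → ℚ
ι z = z ℚ./ 1

-- Division on ℚ normalises by a gcd and does not compute on a variable z. In canonical form
-- numerators and products do compute.
ι-canonical : ∀ z → ι z ≡ mkℚ z 0 (coprime-sym (1-coprimeTo ∣ z ∣))
ι-canonical z = ℚₚ.↥p/↧p≡p (mkℚ z 0 (coprime-sym (1-coprimeTo ∣ z ∣)))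

ι-injective : ∀ {a b} → ι a ≡ ι b → a ≡ b
ι-injective {a} {b} eq = cong ↥_ (trans (sym (ι-canonical a)) (trans eq (ι-canonical b)))

ι-* : ∀ a b → ι (a * b) ≡ ι a ℚ.* ι b
ι-* a b = sym (cong₂ ℚ._*_ (ι-canonical a) (ι-canonical b))

half-double : ∀ r → (r ℚ./ 2) ℚ.+ (r ℚ./ 2) ≡ ι r
half-double r = begin
  r/2 ℚ.+ r/2                    ≡⟨ cong (λ z → z ℚ.+ z) r/2≡ ⟩
  ι r ℚ.* ½ ℚ.+ ι r ℚ.* ½        ≡⟨ sym (ℚₚ.*-distribˡ-+ (ι r) ½ ½) ⟩
  ι r ℚ.* 1ℚ                     ≡⟨ ℚₚ.*-identityʳ (ι r) ⟩
  ι r ∎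
  where
  open ≡-Reasoning
  r/2 = r ℚ./ 2
  r/2≡ : r/2 ≡ ι r ℚ.* ½
  r/2≡ = sym (trans (cong (ℚ._* ½) (ι-canonical r)) (cong (ℚ._/ 2) (ℤₚ.*-identityʳ r)))

ℚ-cancel : ∀ {x y} → x ≢ 0ℚ → x ℚ.* y ≡ 0ℚ → y ≡ 0ℚ
ℚ-cancel {x} {y} x≢0 eq = begin
  y                        ≡⟨ sym (ℚₚ.*-identityˡ y) ⟩
  1ℚ ℚ.* y                 ≡⟨ cong (ℚ._* y) (sym (ℚₚ.*-inverseˡ x)) ⟩
  ℚ.1/ x ℚ.* x ℚ.* y       ≡⟨ ℚₚ.*-assoc (ℚ.1/ x) x y ⟩
  ℚ.1/ x ℚ.* (x ℚ.* y)     ≡⟨ cong (ℚ.1/ x ℚ.*_) eq ⟩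
  ℚ.1/ x ℚ.* 0ℚ            ≡⟨ ℚₚ.*-zeroʳ (ℚ.1/ x) ⟩
  0ℚ ∎
  where
  open ≡-Reasoning
  instance _ = ℚ.≢-nonZero x≢0

-- Write l₁ = a + b√Δ and l₂ = c + d√Δ. That U₀ and U₁ have no surd part forces a = c, and their
-- rational parts give 2U₁ - rU₀ = Δ (b - d), so the equation on U is equivalent to b = d.
binet-coefficients : ∀ r Δ (U : ℕ → ℤ) → Δ ≢ + 0 → (l₁ l₂ : QF) →
  ((n : ℕ) → ofℤ (U n) ≡ (mulQ Δ l₁ (powQ Δ (rootα r) n) ⊕ mulQ Δ l₂ (powQ Δ (rootβ r) n))) →
  (l₁ ≡ l₂ → + 2 * U 1 ≡ r * U 0) × (+ 2 * U 1 ≡ r * U 0 → l₁ ≡ l₂)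
binet-coefficients r Δ U Δ≢0 (a , b) (c , d) binet = forward , backward
  where
  open ≡-Reasoning
  δ = ι Δ
  ρ = r ℚ./ 2
  -- The coordinates of α and β are left in the form in which `powQ` computes them at exponent 1, so
  -- that the projections of `binet 1` have the stated types by computation.
  A₁ = ρ ℚ.* 1ℚ ℚ.+ δ ℚ.* ½ ℚ.* 0ℚ
  A₂ = ρ ℚ.* 0ℚ ℚ.+ ½ ℚ.* 1ℚ
  B₁ = ρ ℚ.* 1ℚ ℚ.+ δ ℚ.* -½ ℚ.* 0ℚ
  B₂ = ρ ℚ.* 0ℚ ℚ.+ -½ ℚ.* 1ℚ
  U₀-rational : ι (U 0) ≡ (a ℚ.* 1ℚ ℚ.+ δ ℚ.* b ℚ.* 0ℚ) ℚ.+ (c ℚ.* 1ℚ ℚ.+ δ ℚ.* d ℚ.* 0ℚ)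
  U₀-rational = cong proj₁ (binet 0)
  U₀-surd : 0ℚ ≡ (a ℚ.* 0ℚ ℚ.+ b ℚ.* 1ℚ) ℚ.+ (c ℚ.* 0ℚ ℚ.+ d ℚ.* 1ℚ)
  U₀-surd = cong proj₂ (binet 0)
  U₁-rational : ι (U 1) ≡ (a ℚ.* A₁ ℚ.+ δ ℚ.* b ℚ.* A₂) ℚ.+ (c ℚ.* B₁ ℚ.+ δ ℚ.* d ℚ.* B₂)
  U₁-rational = cong proj₁ (binet 1)
  U₁-surd : 0ℚ ≡ (a ℚ.* A₂ ℚ.+ b ℚ.* A₁) ℚ.+ (c ℚ.* B₂ ℚ.+ d ℚ.* B₁)
  U₁-surd = cong proj₂ (binet 1)
  open +-*-Solver
  X≡ : ι (+ 2 * U 1) ℚ.- ι (r * U 0) ≡ δ ℚ.* (b ℚ.- d)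
  X≡ = begin
    ι (+ 2 * U 1) ℚ.- ι (r * U 0)
      ≡⟨ cong₂ ℚ._-_ (ι-* (+ 2) (U 1)) (trans (ι-* r (U 0)) (cong (ℚ._* ι (U 0)) (sym (half-double r)))) ⟩
    ι (+ 2) ℚ.* ι (U 1) ℚ.- (ρ ℚ.+ ρ) ℚ.* ι (U 0)
      ≡⟨ cong₂ (λ x y → ι (+ 2) ℚ.* x ℚ.- (ρ ℚ.+ ρ) ℚ.* y) U₁-rational U₀-rational ⟩
    _
      ≡⟨ solve 6 (λ a b c d δ ρ →
           let A₁ = ρ :* con 1ℚ :+ δ :* con ½ :* con 0ℚ
               A₂ = ρ :* con 0ℚ :+ con ½ :* con 1ℚ
               B₁ = ρ :* con 1ℚ :+ δ :* con -½ :* con 0ℚ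
               B₂ = ρ :* con 0ℚ :+ con -½ :* con 1ℚ
           in con (ι (+ 2)) :* ((a :* A₁ :+ δ :* b :* A₂) :+ (c :* B₁ :+ δ :* d :* B₂))
              :- (ρ :+ ρ) :* ((a :* con 1ℚ :+ δ :* b :* con 0ℚ) :+ (c :* con 1ℚ :+ δ :* d :* con 0ℚ))
              := δ :* (b :- d)) refl a b c d δ ρ ⟩
    δ ℚ.* (b ℚ.- d) ∎
  ℚ-subtract : ∀ {x y} → x ℚ.- y ≡ 0ℚ → x ≡ y
  ℚ-subtract {x} {y} eq = trans (solve 2 (λ x y → x := (x :- y) :+ y) refl x y)
      (trans (cong (ℚ._+ y) eq) (ℚₚ.+-identityˡ y))
  a≡c : a ≡ c
  a≡c = ℚ-subtract (begin
    a ℚ.- c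
      ≡⟨ solve 6 (λ a b c d δ ρ →
           let A₁ = ρ :* con 1ℚ :+ δ :* con ½ :* con 0ℚ
               A₂ = ρ :* con 0ℚ :+ con ½ :* con 1ℚ
               B₁ = ρ :* con 1ℚ :+ δ :* con -½ :* con 0ℚ
               B₂ = ρ :* con 0ℚ :+ con -½ :* con 1ℚ
           in a :- c := con (ι (+ 2)) :* ((a :* A₂ :+ b :* A₁) :+ (c :* B₂ :+ d :* B₁))
              :- (ρ :+ ρ) :* ((a :* con 0ℚ :+ b :* con 1ℚ) :+ (c :* con 0ℚ :+ d :* con 1ℚ))) refl a b c d δ ρ ⟩
    _
      ≡⟨ cong₂ (λ x y → ι (+ 2) ℚ.* x ℚ.- (ρ ℚ.+ ρ) ℚ.* y) (sym U₁-surd) (sym U₀-surd) ⟩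
    ι (+ 2) ℚ.* 0ℚ ℚ.- (ρ ℚ.+ ρ) ℚ.* 0ℚ
      ≡⟨ solve 1 (λ ρ → con (ι (+ 2)) :* con 0ℚ :- (ρ :+ ρ) :* con 0ℚ := con 0ℚ) refl ρ ⟩
    0ℚ ∎)
  forward : (a , b) ≡ (c , d) → + 2 * U 1 ≡ r * U 0
  forward refl = ι-injective (ℚ-subtract (trans X≡ (solve 2 (λ δ b → δ :* (b :- b) := con 0ℚ) refl δ b)))
  backward : + 2 * U 1 ≡ r * U 0 → (a , b) ≡ (c , d)
  backward eq = cong₂ _,_ a≡c (ℚ-subtract (ℚ-cancel {δ} (λ δ≡0 → Δ≢0 (ι-injective δ≡0)) (trans (sym X≡)
    (trans (cong (λ z → ι z ℚ.- ι (r * U 0)) eq) (ℚₚ.+-inverseʳ (ι (r * U 0)))))))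

theorem1 : (r₁ r₂ : ℤ) (U : ℕ → ℤ)
    → ((n : ℕ) → U (suc (suc n)) ≡ r₁ * U (suc n) + r₂ * U n)
    → rootα r₁ ≢ rootβ r₁
    → ((k : ℤ) → k * k ≢ disc r₁ r₂)
    → (l₁ l₂ : QF)
    → ((n : ℕ) → ofℤ (U n) ≡ (mulQ (disc r₁ r₂) l₁ (powQ (disc r₁ r₂) (rootα r₁) n) ⊕ mulQ (disc r₁ r₂) l₂
        (powQ (disc r₁ r₂) (rootβ r₁) n)))
    → (AlmostDold U ⇔ (l₁ ≡ l₂)) × ((l₁ ≡ l₂) ⇔ Dold (λ n → + 2 * r₂ * rad (disc r₁ r₂) * U n))
theorem1 r₁ r₂ U rec _ nonsquare l₁ l₂ binet =
    mk⇔ (λ { (suc c , _ , dold) → proj₂ coefficients (almostDold-obstruction r₁ r₂ U rec nonsquare (+ suc c)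
        (λ ()) dold) })
        -- The constant 2 is the denominator of U₀ / 2.
        (λ eq → 2 , ℕ.s≤s ℕ.z≤n , dold-double-multiple r₁ r₂ U rec (proj₁ coefficients eq) (+ 1))
  , mk⇔ (λ eq → dold-cong (λ n → cong (_* U n) (sym (ℤₚ.*-assoc (+ 2) r₂ R)))
                          (dold-double-multiple r₁ r₂ U rec (proj₁ coefficients eq) (r₂ * R)))
        (λ dold → proj₂ coefficients (almostDold-obstruction r₁ r₂ U rec nonsquare
            (+ 2 * r₂ * R) factor≢0 dold))
  where
  R = rad (disc r₁ r₂)
  disc≢0 : disc r₁ r₂ ≢ + 0
  disc≢0 eq = nonsquare (+ 0) (sym eq)
  -- For r₂ = 0 the discriminant would be the square of r₁.
  r₂≢0 : r₂ ≢ + 0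
  r₂≢0 refl = nonsquare r₁ (sym (ℤₚ.+-identityʳ (r₁ * r₁)))
  factor≢0 : + 2 * r₂ * R ≢ + 0
  factor≢0 eq = [ (λ 2r₂≡0 → [ (λ ()) , r₂≢0 ]′ (ℤₚ.i*j≡0⇒i≡0∨j≡0 (+ 2) 2r₂≡0)) , rad-≢0 (disc r₁ r₂) ]′
    (ℤₚ.i*j≡0⇒i≡0∨j≡0 (+ 2 * r₂) eq)
  coefficients = binet-coefficients r₁ (disc r₁ r₂) U disc≢0 l₁ l₂ binet
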